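{- Let $F$ be a formula in 2-XNF in the variables $X_1,\dots,X_n$ with an implication graph structure $(L,V,E)$, and let $\sigma$ be a term ordering. Then the recursive procedure $\mathrm{SOLVER}_\sigma$ (described in the context), applied to $(L,V,E)$, terminates after finitely many steps; it returns UNSAT if and only if $\mathcal{S}(F)=\emptyset$, and otherwise it returns an element $a\in\mathcal{S}(F)$.
   Context: $\mathbb{B}_n=\mathbb{F}_2[X_1,\dots,X_n]/\langle X_1^2-X_1,\dots,X_n^2-X_n\rangle$ is the ring of Boolean polynomials, $x_i$ the residue class of $X_i$, and $\mathbb{L}_n=\langle 1,x_1,\dots,x_n\rangle_{\mathbb{F}_2}$ the space of linear Boolean polynomials. $\mathcal{Z}(S)\subseteq\mathbb{F}_2^n$ is the set of common zeros of $S\subseteq\mathbb{B}_n$. A term ordering $\sigma$ on $\mathbb{F}_2[X_1,\dots,X_n]$ induces an ordering on the square-free terms of $\mathbb{B}_n$, and $\mathrm{LT}_\sigma(f)$ is the largest term in the support of $f\neq 0$. $\mathrm{NR}_\sigma(f,L)$ is the normal remainder of $f$ under the division algorithm by the elements of $L$ with respect to $\sigma$ (performed on the canonical square-free representatives). A lineral is an XOR of literals; a formula is in 2-XNF if it is a conjunction of clauses each of which is a disjunction of at most two linerals. For such a formula $F$ in $X_1,\dots,X_n$ (true $=1$, false $=0$), $\mathcal{S}(F)\subseteq\mathbb{F}_2^n$ is its set of satisfying assignments, and $I_F\subseteq\mathbb{B}_n$ is the unique ideal with $\mathcal{Z}(I_F)=\mathcal{S}(F)$. An implication graph structure (IGS)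 for $F$ is a tuple $(L,V,E)$ with $L,V\subseteq\mathbb{L}_n$ and $E\subseteq V^2$ such that (1) $I_F=\langle L\rangle+\langle fg\mid (f+1,g)\in E\rangle$; (2) for all $(f+1,g)\in E$ we have $(g+1,f)\in E$; (3) for all $f\in V$, $(f,f)\notin E$. A path $f\to g$ is a sequence $f=f_1,\dots,f_s=g$ in $V$ with $(f_i,f_{i+1})\in E$ for $1\le i\le s-1$. For $f\in V$ let $D_f=\{f\}\cup\{g\in V\mid\text{there is a path } f\to g\}$. Procedure $\mathrm{GGCP}_\sigma(G)$: Line 1: Write $G=(L,V,E)$ and replace $L$ by an $\mathbb{F}_2$-basis of $\langle L\rangle_{\mathbb{F}_2}$ whose elements have pairwise distinct leading terms. Line 2: Let $(L',V',E')=(L,\emptyset,\emptyset)$. Lines 3-8: For each $(f,g)\in E$: let $f'=\mathrm{NR}_\sigma(f,L)$ and $g'=\mathrm{NR}_\sigma(g,L)$; if $f'=0$ and $g'\ne0$, append $g'$ to $L'$; if $g'=1$ and $f'\neq1$, append $f'+1$ to $L'$; if $f'\notin\mathbb{F}_2$ and $g'\notin\mathbb{F}_2$ and $f'\ne g'$, append $(f',g')$ to $E'$ and append $f'$ and $g'$ to $V'$. Line 9: If $L\ne L'$, set $G=(L',V',E')$ and go to Line 1. Line 10: Otherwise return $(L',V',E')$. Procedure $\mathrm{crGGCP}_\sigma(G)$: Line 1: Compute $(L',V',E')=\mathrm{GGCP}_\sigma(G)$ and let $L_{SCC}=\emptyset$. Line 2: Compute the set $\mathcal{C}$ of all strongly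 connected components of $(V',E')$ (single vertices allowed). Line 3: If $\#\mathcal{C}$ is odd, return $(\{1,x_1,\dots,x_n\},\emptyset,\emptyset)$. Lines 4-5: For each $S=\{f_1,\dots,f_r\}\in\mathcal{C}$ append $f_1+f_i$ to $L_{SCC}$ for all $i\in\{2,\dots,r\}$. Line 6: If $L_{SCC}\neq\emptyset$, set $G=(L'\cup L_{SCC},V',E')$ and go to Line 1. Line 7: Otherwise return $(L',V',E')$. $\mathrm{tFLS}(L,V,E)$, for an acyclic IGS, returns the set of all trivial failed linerals, i.e. of all $f\in V$ for which there is a path $f\to f+1$, or there is $g\in V$ with paths $f\to g$ and $f\to g+1$. Decisions: for an IGS $(L,V,E)$ of the kind returned by $\mathrm{crGGCP}_\sigma$ with $E\neq\emptyset$, a pair $(L_0,L_1)$ of subsets of $\mathbb{L}_n$ is computed by one of the following heuristics. MaxReach: $(D_f,\{f+1\})$ where $f\in V$ is a source (vertex without incoming edges) such that the number of paths starting at $f$ is maximal. MaxBottleneck: $(D_f,D_{f+1})$ where $f\in V$ maximizes the number of paths ending in $f$ plus the number of paths starting at $f$. MaxPath: $(\{f_1+f_i\mid 1\le i\le r\},\{f_1+1,f_r\})$ where $f_1,\dots,f_r$ (with $(f_i,f_{i+1})\in E$) is a path of maximal length in $(V,E)$. Procedure $\mathrm{SOLVER}_\sigma(L,V,E)$: Line 1: Let $(L,V,E)=\mathrm{crGGCP}_\sigma(L,V,E)$. Line 2: Let $L_{FL}=\mathrm{tFLS}(L,V,E)$ and adjoin $1+L_{FL}=\{f+1\mid f\in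 L_{FL}\}$ to $L$. Line 3: If $L_{FL}\neq\emptyset$, go to Line 1. Line 4: If $1\in\langle L\rangle_{\mathbb{F}_2}$, return UNSAT. Line 5: If $E=\emptyset$, return some $a\in\mathcal{Z}(L)\subseteq\mathbb{F}_2^n$. Line 6: Compute a decision $(L_0,L_1)$ for $(L,V,E)$ with one of the heuristics above. Line 7: If $\mathrm{SOLVER}_\sigma(L\cup L_0,V,E)$ returns some $a\in\mathbb{F}_2^n$, return $a$. Line 8: Otherwise return the result of $\mathrm{SOLVER}_\sigma(L\cup L_1,V,E)$. -}

module Defs where

open import Data.Bool.Base using (Bool; true; false; _xor_; _∧_; not; if_then_else_)
import Data.Bool.Properties as Bool
open import Data.Fin.Base using (Fin)
open import Data.Fin.Subset using (Subset; inside; outside; _⊆_; _⊈_; _─_)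
open import Data.List.Base
  using (List; []; _∷_; _++_; length; map; concatMap; foldr; all; any; tabulate)
open import Data.List.Membership.Propositional using (_∈_; _∉_)
open import Data.List.Relation.Binary.BagAndSetEquality using (_∼[_]_; set)
open import Data.List.Relation.Unary.AllPairs using (AllPairs)
open import Data.List.Relation.Unary.Unique.Propositional using (Unique)
open import Data.Nat.Base using (ℕ; zero; suc; _+_; _≤_)
open import Data.Nat.Divisibility using (_∤_)
open import Data.Product.Base using (∃; ∃₂; _×_; _,_)
open import Data.Sum.Base using (_⊎_)
open import Data.Unit.Base using (⊤)
open import Data.Vec.Base as Vec using (Vec; []; _∷_; lookup; replicate; zipWith; _[_]≔_)
import Data.Vec.Properties as Vec
open import Function.Bundles using (_⇔_)
open import Level using (0ℓ)
open import Relation.Binary.Core using (Rel)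
open import Relation.Binary.Definitions using (DecidableEquality)
open import Relation.Binary.PropositionalEquality.Core using (_≡_; _≢_; refl; cong; cong₂)
open import Relation.Binary.Structures using (IsTotalOrder)
open import Relation.Nullary.Decidable using (Dec; yes; no; ⌊_⌋; map′; ¬?; _×-dec_)
open import Relation.Nullary.Negation using (¬_)
open import Relation.Unary using (Pred; _≐_; Empty; Satisfiable)

private
  variable
    n : ℕ
    A B : Set

-- 𝔽₂ is Bool with _xor_ as addition and _∧_ as multiplication.

Assignment : ℕ → Set
Assignment n = Vec Bool n

------------------------------------------------------------------------
-- Boolean polynomials

infix  5 _+x·_
infixl 6 _+ᴮ_
infixl 7 _*ᴮ_

-- 𝔹 (1+n) is 𝔹 n [x] / ⟨x² - x⟩, which is free over 𝔹 n with basis 1, x: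
-- p +x· q stands for p + x q, where x is the first variable and p, q are
-- polynomials in the remaining ones.  Every residue class has exactly one
-- representation, so _≡_ is equality in 𝔽₂[X₁,…,Xₙ] / ⟨Xᵢ² - Xᵢ⟩.
data 𝔹 : ℕ → Set where
  const : Bool → 𝔹 0
  _+x·_ : 𝔹 n → 𝔹 n → 𝔹 (suc n)

0ᴮ : 𝔹 n
0ᴮ {zero}  = const false
0ᴮ {suc _} = 0ᴮ +x· 0ᴮ

_+ᴮ_ : 𝔹 n → 𝔹 n → 𝔹 n
const c    +ᴮ const d    = const (c xor d)
(p +x· q) +ᴮ (r +x· s) = (p +ᴮ r) +x· (q +ᴮ s)

-- (p + x q)(r + x s) = p r + x (p s + q r + q s), because x² = x.
_*ᴮ_ : 𝔹 n → 𝔹 n → 𝔹 n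
const c    *ᴮ const d    = const (c ∧ d)
(p +x· q) *ᴮ (r +x· s) = (p *ᴮ r) +x· (p *ᴮ s +ᴮ q *ᴮ r +ᴮ q *ᴮ s)

eval : 𝔹 n → Assignment n → Bool
eval (const c)  []      = c
eval (p +x· q) (a ∷ as) = eval p as xor (a ∧ eval q as)

-- A subset of the variables stands for their product, a square-free term.

coeff : 𝔹 n → Subset n → Bool
coeff (const c)  []            = c
coeff (p +x· q) (outside ∷ t) = coeff p t
coeff (p +x· q) (inside  ∷ t) = coeff q t

term : Subset n → 𝔹 n
term []            = const true
term (outside ∷ t) = term t +x· 0ᴮ
term (inside  ∷ t) = 0ᴮ +x· term t

𝒵 : Pred (𝔹 n) 0ℓ → Pred (Assignment n) 0ℓ
𝒵 S a = ∀ p → S p → eval p a ≡ false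

record IsIdeal (I : Pred (𝔹 n) 0ℓ) : Set where
  field
    0-closed : I 0ᴮ
    +-closed : ∀ {p q} → I p → I q → I (p +ᴮ q)
    *-closed : ∀ h {p} → I p → I (h *ᴮ p)

-- The ideal generated by S.
data ⟨_⟩ (S : Pred (𝔹 n) 0ℓ) : Pred (𝔹 n) 0ℓ where
  generator : ∀ {p} → S p → ⟨ S ⟩ p
  zero      : ⟨ S ⟩ 0ᴮ
  plus      : ∀ {p q} → ⟨ S ⟩ p → ⟨ S ⟩ q → ⟨ S ⟩ (p +ᴮ q)
  times     : ∀ h {p} → ⟨ S ⟩ p → ⟨ S ⟩ (h *ᴮ p)

_+ᴵ_ : Pred (𝔹 n) 0ℓ → Pred (𝔹 n) 0ℓ → Pred (𝔹 n) 0ℓ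
(I +ᴵ J) r = ∃₂ λ p q → I p × J q × r ≡ p +ᴮ q

------------------------------------------------------------------------
-- Term orderings and division

-- A term of 𝔽₂[X₁,…,Xₙ] is given by its exponents, so that multiplication of
-- terms is zipWith _+_.
record TermOrdering (n : ℕ) : Set₁ where
  infix 4 _≤ₜ_
  field
    _≤ₜ_         : Rel (Vec ℕ n) 0ℓ
    isTotalOrder : IsTotalOrder _≡_ _≤ₜ_
    1-minimum    : ∀ t → replicate n 0 ≤ₜ t
    *-monoʳ      : ∀ u {s t} → s ≤ₜ t → zipWith _+_ u s ≤ₜ zipWith _+_ u t

exponents : Subset n → Vec ℕ n
exponents = Vec.map (λ b → if b then 1 else 0)

-- IsLT σ p t says that t is the leading term of p; the polynomial 0 has none.
record IsLT (σ : TermOrdering n) (p : 𝔹 n) (t : Subset n) : Set where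
  open TermOrdering σ
  field
    inSupport : coeff p t ≡ true
    largest   : ∀ u → coeff p u ≡ true → exponents u ≤ₜ exponents t

-- NR σ G p r says that the division algorithm, dividing p by the elements of
-- G, can end with remainder r.  Divisibility of square-free terms is _⊆_, and
-- t ─ u is the quotient of t by u.
data NR (σ : TermOrdering n) (G : List (𝔹 n)) : 𝔹 n → 𝔹 n → Set where
  done   : NR σ G 0ᴮ 0ᴮ
  reduce : ∀ {p r g t u} → IsLT σ p t → g ∈ G → IsLT σ g u → u ⊆ t →
           NR σ G (p +ᴮ term (t ─ u) *ᴮ g) r → NR σ G p r
  keep   : ∀ {p r t} → IsLT σ p t →
           (∀ {g u} → g ∈ G → IsLT σ g u → u ⊈ t) →
           NR σ G (p +ᴮ term t) r → NR σ G p (term t +ᴮ r)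

------------------------------------------------------------------------
-- Linear Boolean polynomials

infixl 6 _+ᴸ_
infixl 7 _·ᴸ_

-- c + b₁x₁ + ⋯ + bₙxₙ, given by its coordinates in the basis 1, x₁, …, xₙ.
record 𝕃 (n : ℕ) : Set where
  constructor linear
  field
    constant     : Bool
    coefficients : Vec Bool n

0ᴸ 1ᴸ : 𝕃 n
0ᴸ = linear false (replicate _ false)
1ᴸ = linear true  (replicate _ false)

xᴸ : Fin n → 𝕃 n
xᴸ i = linear false (replicate _ false [ i ]≔ true)

_+ᴸ_ : 𝕃 n → 𝕃 n → 𝕃 n
linear c bs +ᴸ linear d ds = linear (c xor d) (zipWith _xor_ bs ds)

_·ᴸ_ : Bool → 𝕃 n → 𝕃 n
e ·ᴸ linear c bs = linear (e ∧ c) (Vec.map (e ∧_) bs)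

_≟ᴸ_ : DecidableEquality (𝕃 n)
linear c bs ≟ᴸ linear d ds =
  map′ (λ (p , q) → cong₂ linear p q)
       (λ e → cong 𝕃.constant e , cong 𝕃.coefficients e)
       ((c Bool.≟ d) ×-dec Vec.≡-dec Bool._≟_ bs ds)

constᴮ : Bool → 𝔹 n
constᴮ {zero}  c = const c
constᴮ {suc _} c = constᴮ c +x· 0ᴮ

-- The inclusion of 𝕃 n in 𝔹 n.
ι : 𝕃 n → 𝔹 n
ι (linear c [])       = const c
ι (linear c (b ∷ bs)) = ι (linear c bs) +x· constᴮ b

lincomb : (fs : List (𝕃 n)) → Vec Bool (length fs) → 𝕃 n
lincomb []       []       = 0ᴸ
lincomb (f ∷ fs) (c ∷ cs) = c ·ᴸ f +ᴸ lincomb fs cs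

Span : List (𝕃 n) → Pred (𝕃 n) 0ℓ
Span fs g = ∃ λ cs → lincomb fs cs ≡ g

LinearlyIndependent : Pred (List (𝕃 n)) 0ℓ
LinearlyIndependent fs = ∀ cs → lincomb fs cs ≡ 0ᴸ → cs ≡ replicate _ false

-- B is a basis of the span of L with pairwise distinct leading terms.
record IsReducedBasis (σ : TermOrdering n) (L B : List (𝕃 n)) : Set where
  field
    independent : LinearlyIndependent B
    spans       : Span B ≐ Span L
    distinctLT  : AllPairs (λ f g → ∀ {t u} → IsLT σ (ι f) t → IsLT σ (ι g) u → t ≢ u) B

------------------------------------------------------------------------
-- Formulas in 2-XNF

data Literal (n : ℕ) : Set where
  pos neg : Fin n → Literal n

Lineral : ℕ → Set
Lineral n = List (Literal n)

record Clause (n : ℕ) : Set where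
  field
    linerals : List (Lineral n)
    width≤2  : length linerals ≤ 2

Formula : ℕ → Set
Formula n = List (Clause n)

evalLiteral : Assignment n → Literal n → Bool
evalLiteral a (pos i) = lookup a i
evalLiteral a (neg i) = not (lookup a i)

evalLineral : Assignment n → Lineral n → Bool
evalLineral a = foldr (λ l b → evalLiteral a l xor b) false

evalClause : Assignment n → Clause n → Bool
evalClause a c = any (evalLineral a) (Clause.linerals c)

𝒮 : Formula n → Pred (Assignment n) 0ℓ
𝒮 F a = all (evalClause a) F ≡ true

------------------------------------------------------------------------
-- Implication graph structures

-- Lists are used as finite sets: order and repetitions carry no meaning.
record Graph (n : ℕ) : Set where
  constructor graph
  field
    L : List (𝕃 n)
    V : List (𝕃 n)
    E : List (𝕃 n × 𝕃 n)

record IsIdealOf (F : Formula n) (I : Pred (𝔹 n) 0ℓ) : Set where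
  field
    isIdeal : IsIdeal I
    zeros   : 𝒵 I ≐ 𝒮 F

record IsIGS (F : Formula n) (G : Graph n) : Set₁ where
  open Graph G
  field
    E⊆V²        : ∀ {f g} → (f , g) ∈ E → f ∈ V × g ∈ V
    represents  : ∃ λ I_F → IsIdealOf F I_F ×
                  I_F ≐ (⟨ (_∈ map ι L) ⟩ +ᴵ
                         ⟨ (λ p → ∃₂ λ f g → (f +ᴸ 1ᴸ , g) ∈ E × p ≡ ι f *ᴮ ι g) ⟩)
    skew        : ∀ {f g} → (f +ᴸ 1ᴸ , g) ∈ E → (g +ᴸ 1ᴸ , f) ∈ E
    irreflexive : ∀ {f} → f ∈ V → (f , f) ∉ E

module _ (G : Graph n) where
  open Graph G

  -- Path f ps g says that ps is the vertex sequence of a path from f to g,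
  -- both endpoints included.
  data Path : 𝕃 n → List (𝕃 n) → 𝕃 n → Set where
    stop : ∀ {f} → f ∈ V → Path f (f ∷ []) f
    step : ∀ {f g ps h} → f ∈ V → (f , g) ∈ E → Path g ps h → Path f (f ∷ ps) h

  Reach : Rel (𝕃 n) 0ℓ
  Reach f g = ∃ λ ps → Path f ps g

  PathFrom PathTo : 𝕃 n → Pred (List (𝕃 n)) 0ℓ
  PathFrom f ps = ∃ λ g → Path f ps g
  PathTo   g ps = ∃ λ f → Path f ps g

  IsSCC : Pred (List (𝕃 n)) 0ℓ
  IsSCC S = ∃ λ f → f ∈ V × (∀ g → g ∈ S ⇔ (g ∈ V × Reach f g × Reach g f))

  -- Unlike for other lists, repetitions are excluded here, because the
  -- components are counted.
  record AreSCCs (𝒞 : List (List (𝕃 n))) : Set where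
    field
      sound    : ∀ {S} → S ∈ 𝒞 → IsSCC S × Unique S
      complete : ∀ {f} → f ∈ V → ∃ λ S → S ∈ 𝒞 × f ∈ S
      distinct : AllPairs (λ S T → ¬ (S ∼[ set ] T)) 𝒞

  TrivialFailed : Pred (𝕃 n) 0ℓ
  TrivialFailed f = f ∈ V ×
    (Reach f (f +ᴸ 1ᴸ) ⊎ ∃ λ g → g ∈ V × Reach f g × Reach f (g +ᴸ 1ᴸ))

  IsTFLS : Pred (List (𝕃 n)) 0ℓ
  IsTFLS L_FL = ∀ f → f ∈ L_FL ⇔ TrivialFailed f

  -- IsD f D says that D is the set D_f.
  IsD : 𝕃 n → Pred (List (𝕃 n)) 0ℓ
  IsD f D = ∀ g → g ∈ D ⇔ (g ≡ f ⊎ (g ∈ V × Reach f g))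

  IsSource : Pred (𝕃 n) 0ℓ
  IsSource f = f ∈ V × (∀ g → (g , f) ∉ E)

HasSize : Pred A 0ℓ → ℕ → Set
HasSize P k = ∃ λ xs → Unique xs × (∀ x → x ∈ xs ⇔ P x) × length xs ≡ k

data Heuristic : Set where
  maxReach maxBottleneck maxPath : Heuristic

data IsDecision (G : Graph n) : Heuristic → List (𝕃 n) × List (𝕃 n) → Set where
  byReach : ∀ {f k D} →
    IsSource G f →
    HasSize (PathFrom G f) k →
    (∀ g l → IsSource G g → HasSize (PathFrom G g) l → l ≤ k) →
    IsD G f D →
    IsDecision G maxReach (D , (f +ᴸ 1ᴸ) ∷ [])
  byBottleneck : ∀ {f k₁ k₂ D₀ D₁} →
    f ∈ Graph.V G →
    HasSize (PathTo G f) k₁ → HasSize (PathFrom G f) k₂ →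
    (∀ g l₁ l₂ → g ∈ Graph.V G →
       HasSize (PathTo G g) l₁ → HasSize (PathFrom G g) l₂ → l₁ + l₂ ≤ k₁ + k₂) →
    IsD G f D₀ → IsD G (f +ᴸ 1ᴸ) D₁ →
    IsDecision G maxBottleneck (D₀ , D₁)
  byPath : ∀ {f ps h} →
    Path G f ps h →
    (∀ f′ qs h′ → Path G f′ qs h′ → length qs ≤ length ps) →
    IsDecision G maxPath (map (f +ᴸ_) ps , (f +ᴸ 1ᴸ) ∷ h ∷ [])

------------------------------------------------------------------------
-- Programs

data Procedure : Set where
  GGCP crGGCP SOLVER : Procedure

data Result (n : ℕ) : Set where
  UNSAT : Result n
  SAT   : Assignment n → Result n

Output : Procedure → ℕ → Set
Output GGCP   n = Graph n
Output crGGCP n = Graph n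
Output SOLVER n = Result n

-- Nondeterministic programs with calls to the three procedures.  choose P
-- obtains an arbitrary x satisfying P, and gets stuck if there is none.
data Prog (n : ℕ) (A : Set) : Set₁ where
  return   : A → Prog n A
  choose-k : {X : Set} (P : Pred X 0ℓ) → (X → Prog n A) → Prog n A
  call-k   : (π : Procedure) → Graph n → (Output π n → Prog n A) → Prog n A

infixl 1 _>>=_

_>>=_ : Prog n A → (A → Prog n B) → Prog n B
return a       >>= k = k a
choose-k P l   >>= k = choose-k P (λ x → l x >>= k)
call-k π G l   >>= k = call-k π G (λ r → l r >>= k)

choose : Pred A 0ℓ → Prog n A
choose P = choose-k P return

call : (π : Procedure) → Graph n → Prog n (Output π n)
call π G = call-k π G return

-- Branching on A; not getting stuck here means that A can be decided.
test : (A : Set) → Prog n (Dec A)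
test A = choose {A = Dec A} (λ _ → ⊤)

-- The body of the loop over E in GGCP, for an edge with remainders f, g.
addEdge : 𝕃 n → 𝕃 n → Graph n → Graph n
addEdge {n} f g (graph L V E) = graph L₂ V₁ E₁
  where
  L₁ L₂ V₁ : List (𝕃 n)
  L₁ = if ⌊ (f ≟ᴸ 0ᴸ) ×-dec ¬? (g ≟ᴸ 0ᴸ) ⌋ then g ∷ L else L
  L₂ = if ⌊ (g ≟ᴸ 1ᴸ) ×-dec ¬? (f ≟ᴸ 1ᴸ) ⌋ then (f +ᴸ 1ᴸ) ∷ L₁ else L₁

  isEdge : Bool
  isEdge = ⌊ ¬? (f ≟ᴸ 0ᴸ) ×-dec ¬? (f ≟ᴸ 1ᴸ) ×-dec
             ¬? (g ≟ᴸ 0ᴸ) ×-dec ¬? (g ≟ᴸ 1ᴸ) ×-dec ¬? (f ≟ᴸ g) ⌋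

  V₁ = if isEdge then f ∷ g ∷ V else V

  E₁ : List (𝕃 n × 𝕃 n)
  E₁ = if isEdge then (f , g) ∷ E else E

-- f₁ + f₂, …, f₁ + fᵣ
mergers : List (𝕃 n) → List (𝕃 n)
mergers []       = []
mergers (f ∷ fs) = map (f +ᴸ_) fs

decide : Graph n → Prog n (Result n)
decide G@(graph L V E) = do
  h ← choose {A = Heuristic} (λ _ → ⊤)
  (L₀ , L₁) ← choose (IsDecision G h)
  UNSAT ← call SOLVER (graph (L ++ L₀) V E)
    where SAT a → return (SAT a)
  call SOLVER (graph (L ++ L₁) V E)

module _ (σ : TermOrdering n) where

  addEdges : List (𝕃 n) → List (𝕃 n × 𝕃 n) → Graph n → Prog n (Graph n)
  addEdges L []            G′ = return G′
  addEdges L ((f , g) ∷ E) G′ = do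
    f′ ← choose (λ f′ → NR σ (map ι L) (ι f) (ι f′))
    g′ ← choose (λ g′ → NR σ (map ι L) (ι g) (ι g′))
    addEdges L E (addEdge f′ g′ G′)

  ggcp : Graph n → Prog n (Graph n)
  ggcp (graph L₀ V E) = do
    L  ← choose (IsReducedBasis σ L₀)
    G′ ← addEdges L E (graph L [] [])
    yes _ ← test (L ∼[ set ] Graph.L G′)
      where no _ → call GGCP G′
    return G′

  crggcp : Graph n → Prog n (Graph n)
  crggcp G = do
    G′@(graph L′ V′ E′) ← call GGCP G
    𝒞 ← choose (AreSCCs G′)
    no _ ← test (2 ∤ length 𝒞)
      where yes _ → return (graph (1ᴸ ∷ tabulate xᴸ) [] [])
    L-SCC@(_ ∷ _) ← return (concatMap mergers 𝒞)
      where [] → return G′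
    call crGGCP (graph (L′ ++ L-SCC) V′ E′)

  solver : Graph n → Prog n (Result n)
  solver G₀ = do
    G@(graph L V E) ← call crGGCP G₀
    [] ← choose (IsTFLS G)
      where L-FL → call SOLVER (graph (L ++ map (_+ᴸ 1ᴸ) L-FL) V E)
    no _ ← test (Span L 1ᴸ)
      where yes _ → return UNSAT
    [] ← return E
      where _ → decide G
    a ← choose (𝒵 (_∈ map ι L))
    return (SAT a)

  body : (π : Procedure) → Graph n → Prog n (Output π n)
  body GGCP   = ggcp
  body crGGCP = crggcp
  body SOLVER = solver

infix 4 _⊢_⇓_

-- σ ⊢ m ⇓ a says that some finite run of m returns a.
data _⊢_⇓_ (σ : TermOrdering n) : Prog n A → A → Set₁ where
  returns : ∀ {a : A} → σ ⊢ return a ⇓ a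
  chooses : ∀ {X : Set} {P : Pred X 0ℓ} {k : X → Prog n A} {x a} →
           P x → σ ⊢ k x ⇓ a → σ ⊢ choose-k P k ⇓ a
  calls   : ∀ {π G} {k : Output π n → Prog n A} {r a} →
           σ ⊢ body σ π G ⇓ r → σ ⊢ k r ⇓ a → σ ⊢ call-k π G k ⇓ a

-- Halts σ m says that every run of m, whichever choices it makes, returns
-- after finitely many steps; in particular none gets stuck.
data Halts (σ : TermOrdering n) : Prog n A → Set₁ where
  returns : ∀ {a : A} → Halts σ (return a)
  chooses : ∀ {X : Set} {P : Pred X 0ℓ} {k : X → Prog n A} →
           Satisfiable P → (∀ x → P x → Halts σ (k x)) → Halts σ (choose-k P k)
  calls   : ∀ {π G} {k : Output π n → Prog n A} →
           Halts σ (body σ π G) →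
           (∀ r → σ ⊢ body σ π G ⇓ r → Halts σ (k r)) → Halts σ (call-k π G k)

module Submission where

-- Let Z(L) be the set of common zeros of L, and let the solutions of (L, V, E)
-- be the a ∈ Z(L) such that f(a) = 0 implies g(a) = 0 for every (f, g) ∈ E.
-- For an implication graph structure of F these are the satisfying
-- assignments of F.  Every step preserves the set of solutions, or, for a
-- decision, covers it by two such sets.
--
-- For termination, each recursive call of each procedure strictly shrinks
-- Z(L).  Indeed, a linear polynomial d ≠ 0 that is reduced modulo a basis of
-- ⟨L⟩ with distinct leading terms takes the value 1 somewhere on Z(L), and what
-- is adjoined to L contains such a d: a remainder f, f + 1, or the sum of two
-- distinct ones.  The same fact makes normal remainders unique and compatible
-- with f ↦ f + 1, so that GGCP preserves the skew symmetry of E.  If there is a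
-- solution, then the number of strongly connected components is even, because
-- each has a constant value, and S ↦ S + 1 exchanges those of value 0 and 1.

open import Defs
open import Data.Bool.Base using (Bool; true; false; _xor_; _∧_; not; if_then_else_)
import Data.Bool.Properties as Bool
open import Data.Bool.Solver using (module xor-∧-Solver)
open import Data.Empty using (⊥-elim)
open import Data.Fin.Base using (Fin; zero; suc)
open import Data.Fin.Subset using (Subset; inside; outside; ⊥; ⁅_⁆; _─_; _⊆_)
import Data.Fin.Subset.Properties as Subset
open import Data.List.Base
  using (List; []; _∷_; _++_; length; map; filter; concatMap; cartesianProductWith;
         deduplicate; tabulate)
import Data.List.Extrema
import Data.List.Properties as List
open import Data.List.Membership.Propositional using (_∈_; _∉_; find; lose)
open import Data.List.Membership.Propositional.Properties
open import Data.List.Relation.Unary.All as All using (All; []; _∷_)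
import Data.List.Relation.Unary.All.Properties as All
open import Data.List.Relation.Unary.AllPairs as AllPairs using (AllPairs; []; _∷_)
import Data.List.Relation.Unary.AllPairs.Properties as AllPairs
open import Data.List.Relation.Unary.Any as Any using (Any; here; there)
open import Data.List.Relation.Binary.BagAndSetEquality using (_∼[_]_; set)
open import Data.List.Relation.Unary.Unique.Propositional using (Unique)
open import Data.List.Relation.Unary.Unique.DecPropositional.Properties using (deduplicate-!)
open import Data.Nat.Base using (ℕ; zero; suc; _+_; _*_; _≤_; _<_; z≤n; s≤s; s≤s⁻¹)
open import Data.Nat.Divisibility using (_∣_; _∤_; divides; _∣?_)
open import Data.Nat.Induction using (<-wellFounded)
import Data.Nat.Properties as ℕ
open import Induction.WellFounded using (Acc; acc)
open import Data.Product.Base using (∃; ∃₂; _×_; _,_; proj₁; proj₂)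
import Data.Product.Properties as Product
open import Data.Sum.Base as Sum using (_⊎_; inj₁; inj₂; [_,_]′)
open import Data.Vec.Base as Vec using (Vec; []; _∷_; replicate; zipWith)
import Data.Vec.Properties as Vec
open import Function.Base using (_∘_; id; case_of_)
open import Function.Bundles using (_⇔_; mk⇔; Equivalence)
open import Level using (0ℓ; Lift; lift)
open import Relation.Binary.Definitions using (DecidableEquality)
open import Relation.Binary.Bundles using (TotalOrder)
open import Relation.Binary.Structures using (IsTotalOrder)
open import Relation.Binary.PropositionalEquality
  using (_≡_; _≢_; refl; sym; trans; cong; cong₂; subst; subst₂; module ≡-Reasoning)
open import Relation.Nullary.Decidable using (Dec; yes; no; map′; ¬?; _×-dec_; _⊎-dec_; ⌊_⌋)
open import Relation.Nullary.Negation using (¬_; contradiction)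
open import Relation.Unary using (Pred; Decidable; Empty; Satisfiable; _≐_) renaming (_⊆_ to _⇒_)

-- A run gets stuck at a choice without a witness, so halting also demands constructions:
-- remainders, reduced bases, strongly connected components, trivial failed linerals and decisions
-- are all computed. The path counts of the heuristics exist because merging the components has left
-- an acyclic graph.
--
-- Remainders of linear polynomials stay linear, because a divisor of a term of degree at most one
-- is that term or 1. The ideal I_F enters only at the start. From there on, skew symmetry is the
-- one property of the edges that is handed to recursive calls; each round of GGCP establishes the
-- others afresh.
--
-- Taking remainders commutes with adding 1 only if 1 is itself reduced, that is, if L has a zero.
-- If it has none, every remainder is 0 and no edge survives.
--
-- Halting and correctness are proved together, because whether a caller halts depends on what the
-- callee returns. The three inductions are nested: a call to another procedure starts a new
-- induction on the number of zeros, and its postcondition reports that this number has not grown.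

private
  variable
    n : ℕ
    A : Set

-- Boolean polynomials

open xor-∧-Solver using (solve; _:+_; _:*_; _:=_)

eval-+ : (p q : 𝔹 n) (a : Assignment n) → eval (p +ᴮ q) a ≡ eval p a xor eval q a
eval-+ (const c) (const d) [] = refl
eval-+ (p +x· q) (r +x· s) (a ∷ as) rewrite eval-+ p r as | eval-+ q s as =
  solve 5 (λ p q r s a → (p :+ r) :+ a :* (q :+ s) := (p :+ a :* q) :+ (r :+ a :* s))
    refl (eval p as) (eval q as) (eval r as) (eval s as) a

eval-* : (p q : 𝔹 n) (a : Assignment n) → eval (p *ᴮ q) a ≡ eval p a ∧ eval q a
eval-* (const c) (const d) [] = refl
eval-* (p +x· q) (r +x· s) (a ∷ as)
  rewrite eval-+ (p *ᴮ s +ᴮ q *ᴮ r) (q *ᴮ s) as | eval-+ (p *ᴮ s) (q *ᴮ r) as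
        | eval-* p r as | eval-* p s as | eval-* q r as | eval-* q s as
  with a
... | false = trans (Bool.xor-identityʳ (eval p as ∧ eval r as))
                (sym (cong₂ _∧_ (Bool.xor-identityʳ (eval p as)) (Bool.xor-identityʳ (eval r as))))
... | true  =
  solve 4 (λ p q r s → p :* r :+ (p :* s :+ q :* r :+ q :* s) := (p :+ q) :* (r :+ s))
    refl (eval p as) (eval q as) (eval r as) (eval s as)

eval-0 : (a : Assignment n) → eval 0ᴮ a ≡ false
eval-0 []       = refl
eval-0 (a ∷ as) rewrite eval-0 as = Bool.∧-zeroʳ a

eval-constᴮ : (c : Bool) (a : Assignment n) → eval (constᴮ c) a ≡ c
eval-constᴮ c []       = refl
eval-constᴮ c (a ∷ as) rewrite eval-constᴮ c as | eval-0 as | Bool.∧-zeroʳ a = Bool.xor-identityʳ c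

coeff-+ : (p q : 𝔹 n) (t : Subset n) → coeff (p +ᴮ q) t ≡ coeff p t xor coeff q t
coeff-+ (const c) (const d) []            = refl
coeff-+ (p +x· q) (r +x· s) (outside ∷ t) = coeff-+ p r t
coeff-+ (p +x· q) (r +x· s) (inside  ∷ t) = coeff-+ q s t

coeff-0 : (t : Subset n) → coeff 0ᴮ t ≡ false
coeff-0 []            = refl
coeff-0 (outside ∷ t) = coeff-0 t
coeff-0 (inside  ∷ t) = coeff-0 t

coeff-injective-0 : (p : 𝔹 n) → (∀ t → coeff p t ≡ false) → p ≡ 0ᴮ
coeff-injective-0 (const c) p≈0 = cong const (p≈0 [])
coeff-injective-0 (p +x· q) p≈0 =
  cong₂ _+x·_ (coeff-injective-0 p (p≈0 ∘ (outside ∷_))) (coeff-injective-0 q (p≈0 ∘ (inside ∷_)))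

coeff-term : (t : Subset n) → coeff (term t) t ≡ true
coeff-term []            = refl
coeff-term (outside ∷ t) = coeff-term t
coeff-term (inside  ∷ t) = coeff-term t

term-support : (s t : Subset n) → coeff (term s) t ≡ true → t ≡ s
term-support []            []            _ = refl
term-support (outside ∷ s) (outside ∷ t) e = cong (outside ∷_) (term-support s t e)
term-support (outside ∷ s) (inside  ∷ t) e = contradiction (trans (sym (coeff-0 t)) e) λ ()
term-support (inside  ∷ s) (outside ∷ t) e = contradiction (trans (sym (coeff-0 t)) e) λ ()
term-support (inside  ∷ s) (inside  ∷ t) e = cong (inside ∷_) (term-support s t e)

+ᴮ-identityˡ : (p : 𝔹 n) → 0ᴮ +ᴮ p ≡ p
+ᴮ-identityˡ (const c) = refl
+ᴮ-identityˡ (p +x· q) = cong₂ _+x·_ (+ᴮ-identityˡ p) (+ᴮ-identityˡ q)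

+ᴮ-identityʳ : (p : 𝔹 n) → p +ᴮ 0ᴮ ≡ p
+ᴮ-identityʳ (const c) = cong const (Bool.xor-identityʳ c)
+ᴮ-identityʳ (p +x· q) = cong₂ _+x·_ (+ᴮ-identityʳ p) (+ᴮ-identityʳ q)

*ᴮ-zeroˡ : (p : 𝔹 n) → 0ᴮ *ᴮ p ≡ 0ᴮ
*ᴮ-zeroˡ (const c) = refl
*ᴮ-zeroˡ (p +x· q) rewrite *ᴮ-zeroˡ p | *ᴮ-zeroˡ q =
  cong (0ᴮ +x·_) (trans (+ᴮ-identityʳ _) (+ᴮ-identityʳ _))

*ᴮ-zeroʳ : (p : 𝔹 n) → p *ᴮ 0ᴮ ≡ 0ᴮ
*ᴮ-zeroʳ (const c) = cong const (Bool.∧-zeroʳ c)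
*ᴮ-zeroʳ (p +x· q) rewrite *ᴮ-zeroʳ p | *ᴮ-zeroʳ q =
  cong (0ᴮ +x·_) (trans (+ᴮ-identityʳ _) (+ᴮ-identityʳ _))

*ᴮ-identityˡ : (p : 𝔹 n) → constᴮ true *ᴮ p ≡ p
*ᴮ-identityˡ (const c) = refl
*ᴮ-identityˡ (p +x· q) rewrite *ᴮ-identityˡ p | *ᴮ-identityˡ q | *ᴮ-zeroˡ p | *ᴮ-zeroˡ q =
  cong (p +x·_) (trans (+ᴮ-identityʳ _) (+ᴮ-identityʳ _))

*ᴮ-identityʳ : (p : 𝔹 n) → p *ᴮ constᴮ true ≡ p
*ᴮ-identityʳ (const c) = cong const (Bool.∧-identityʳ c)
*ᴮ-identityʳ (p +x· q) rewrite *ᴮ-identityʳ p | *ᴮ-identityʳ q | *ᴮ-zeroʳ p | *ᴮ-zeroʳ q =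
  cong (p +x·_) (trans (+ᴮ-identityʳ _) (+ᴮ-identityˡ _))

-- Linear Boolean polynomials

+ᴸ-assoc : (f g h : 𝕃 n) → (f +ᴸ g) +ᴸ h ≡ f +ᴸ (g +ᴸ h)
+ᴸ-assoc (linear c bs) (linear d ds) (linear e es) =
  cong₂ linear (Bool.xor-assoc c d e) (Vec.zipWith-assoc Bool.xor-assoc bs ds es)

+ᴸ-comm : (f g : 𝕃 n) → f +ᴸ g ≡ g +ᴸ f
+ᴸ-comm (linear c bs) (linear d ds) =
  cong₂ linear (Bool.xor-comm c d) (Vec.zipWith-comm Bool.xor-comm bs ds)

+ᴸ-identityˡ : (f : 𝕃 n) → 0ᴸ +ᴸ f ≡ f
+ᴸ-identityˡ (linear c bs) = cong (linear c) (Vec.zipWith-identityˡ Bool.xor-identityˡ bs)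

+ᴸ-identityʳ : (f : 𝕃 n) → f +ᴸ 0ᴸ ≡ f
+ᴸ-identityʳ f = trans (+ᴸ-comm f 0ᴸ) (+ᴸ-identityˡ f)

+ᴸ-self : (f : 𝕃 n) → f +ᴸ f ≡ 0ᴸ
+ᴸ-self (linear c bs) = cong₂ linear (Bool.xor-same c) (xor-self bs)
  where
  xor-self : ∀ {m} (v : Vec Bool m) → zipWith _xor_ v v ≡ replicate _ false
  xor-self []      = refl
  xor-self (b ∷ v) = cong₂ _∷_ (Bool.xor-same b) (xor-self v)

+ᴸ-cancelˡ : (f g : 𝕃 n) → f +ᴸ (f +ᴸ g) ≡ g
+ᴸ-cancelˡ f g = trans (sym (+ᴸ-assoc f f g)) (trans (cong (_+ᴸ g) (+ᴸ-self f)) (+ᴸ-identityˡ g))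

+ᴸ-cancelʳ : (f g : 𝕃 n) → (f +ᴸ g) +ᴸ g ≡ f
+ᴸ-cancelʳ f g = trans (+ᴸ-assoc f g g) (trans (cong (f +ᴸ_) (+ᴸ-self g)) (+ᴸ-identityʳ f))

+ᴸ≡0⇒≡ : {f g : 𝕃 n} → f +ᴸ g ≡ 0ᴸ → f ≡ g
+ᴸ≡0⇒≡ {f = f} {g} e = trans (sym (+ᴸ-cancelʳ f g)) (trans (cong (_+ᴸ g) e) (+ᴸ-identityˡ g))

·ᴸ-false : (f : 𝕃 n) → false ·ᴸ f ≡ 0ᴸ
·ᴸ-false (linear c bs) = cong (linear false) (Vec.map-const bs false)

·ᴸ-true : (f : 𝕃 n) → true ·ᴸ f ≡ f
·ᴸ-true (linear c bs) = cong (linear c) (Vec.map-id bs)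

constᴮ-false : constᴮ {n} false ≡ 0ᴮ
constᴮ-false {zero}  = refl
constᴮ-false {suc n} = cong (_+x· 0ᴮ) constᴮ-false

constᴮ-+ : (c d : Bool) → constᴮ {n} (c xor d) ≡ constᴮ c +ᴮ constᴮ d
constᴮ-+ {zero}  c d = refl
constᴮ-+ {suc n} c d = cong₂ _+x·_ (constᴮ-+ c d) (sym (+ᴮ-identityˡ 0ᴮ))

ι-+ : (f g : 𝕃 n) → ι (f +ᴸ g) ≡ ι f +ᴮ ι g
ι-+ (linear c [])       (linear d [])       = refl
ι-+ (linear c (b ∷ bs)) (linear d (e ∷ es)) =
  cong₂ _+x·_ (ι-+ (linear c bs) (linear d es)) (constᴮ-+ b e)

ι-linear-replicate : (c : Bool) → ι (linear c (replicate n false)) ≡ constᴮ c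
ι-linear-replicate {zero}  c = refl
ι-linear-replicate {suc n} c = cong₂ _+x·_ (ι-linear-replicate c) constᴮ-false

ι-0 : ι 0ᴸ ≡ 0ᴮ {n}
ι-0 = trans (ι-linear-replicate false) constᴮ-false

ι-injective : (f g : 𝕃 n) → ι f ≡ ι g → f ≡ g
ι-injective (linear c [])       (linear d [])       refl = refl
ι-injective (linear c (b ∷ bs)) (linear d (e ∷ es)) eq   =
  cong₂ (λ f b → linear (𝕃.constant f) (b ∷ 𝕃.coefficients f))
    (ι-injective (linear c bs) (linear d es) (cong low eq))
    (constᴮ-injective (cong high eq))
  where
  low high : ∀ {m} → 𝔹 (suc m) → 𝔹 m
  low  (p +x· q) = p
  high (p +x· q) = q
  constᴮ-injective : ∀ {m b e} → constᴮ {m} b ≡ constᴮ e → b ≡ e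
  constᴮ-injective {m} {b} {e} eq =
    trans (sym (eval-constᴮ b (replicate m false)))
      (trans (cong (λ p → eval p (replicate m false)) eq) (eval-constᴮ e (replicate m false)))

⟦_⟧ : 𝕃 n → Assignment n → Bool
⟦ f ⟧ a = eval (ι f) a

⟦⟧-+ : (f g : 𝕃 n) (a : Assignment n) → ⟦ f +ᴸ g ⟧ a ≡ ⟦ f ⟧ a xor ⟦ g ⟧ a
⟦⟧-+ f g a = trans (cong (λ p → eval p a) (ι-+ f g)) (eval-+ (ι f) (ι g) a)

⟦0⟧ : (a : Assignment n) → ⟦ 0ᴸ ⟧ a ≡ false
⟦0⟧ a = trans (cong (λ p → eval p a) ι-0) (eval-0 a)

⟦1⟧ : (a : Assignment n) → ⟦ 1ᴸ ⟧ a ≡ true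
⟦1⟧ a = trans (cong (λ p → eval p a) (ι-linear-replicate true)) (eval-constᴮ true a)

⟦+1⟧ : (f : 𝕃 n) (a : Assignment n) → ⟦ f +ᴸ 1ᴸ ⟧ a ≡ not (⟦ f ⟧ a)
⟦+1⟧ f a rewrite ⟦⟧-+ f 1ᴸ a | ⟦1⟧ a with ⟦ f ⟧ a
... | false = refl
... | true  = refl

⟦+⟧≡0⇒≡ : (f g : 𝕃 n) (a : Assignment n) → ⟦ f +ᴸ g ⟧ a ≡ false → ⟦ f ⟧ a ≡ ⟦ g ⟧ a
⟦+⟧≡0⇒≡ f g a e rewrite ⟦⟧-+ f g a with ⟦ f ⟧ a | ⟦ g ⟧ a
... | false | false = refl
... | true  | true  = refl

≡⇒⟦+⟧≡0 : (f g : 𝕃 n) (a : Assignment n) → ⟦ f ⟧ a ≡ ⟦ g ⟧ a → ⟦ f +ᴸ g ⟧ a ≡ false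
≡⇒⟦+⟧≡0 f g a e = trans (⟦⟧-+ f g a) (trans (cong (_xor ⟦ g ⟧ a) e) (Bool.xor-same (⟦ g ⟧ a)))

-- The set `𝒵 (_∈ map ι L)` in a form that is decidable, so that its elements can be counted.
Zero : List (𝕃 n) → Pred (Assignment n) _
Zero L a = All (λ f → ⟦ f ⟧ a ≡ false) L

-- Linear spans

-- Induction over a span: over 𝔽₂, a set is a subspace as soon as it contains 0 and is closed under
-- sums.
span-closed : (P : 𝕃 n → Set) → P 0ᴸ → (∀ {f g} → P f → P g → P (f +ᴸ g)) →
              ∀ {L} → All P L → Span L ⇒ P
span-closed P P0 P+ []       ([] , refl)         = P0
span-closed P P0 P+ {f ∷ _} (p ∷ ps) (false ∷ cs , refl) =
  P+ (subst P (sym (·ᴸ-false f)) P0) (span-closed P P0 P+ ps (cs , refl))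
span-closed P P0 P+ {f ∷ _} (p ∷ ps) (true ∷ cs , refl)  =
  P+ (subst P (sym (·ᴸ-true f)) p) (span-closed P P0 P+ ps (cs , refl))

span-0 : (L : List (𝕃 n)) → Span L 0ᴸ
span-0 []      = [] , refl
span-0 (f ∷ L) =
  let cs , e = span-0 L in
  false ∷ cs , trans (cong₂ _+ᴸ_ (·ᴸ-false f) e) (+ᴸ-identityˡ 0ᴸ)

span-+ : (L : List (𝕃 n)) → ∀ {f g} → Span L f → Span L g → Span L (f +ᴸ g)
span-+ []      ([] , refl) ([] , refl) = [] , sym (+ᴸ-identityˡ 0ᴸ)
span-+ (h ∷ L) (c ∷ cs , refl) (d ∷ ds , refl) =
  let es , e = span-+ L (cs , refl) (ds , refl) in
  (c xor d) ∷ es ,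
  trans (cong₂ _+ᴸ_ (·ᴸ-+ c d) e) (interchange (c ·ᴸ h) (d ·ᴸ h) (lincomb L cs) (lincomb L ds))
  where
  ·ᴸ-+ : ∀ c d → (c xor d) ·ᴸ h ≡ c ·ᴸ h +ᴸ d ·ᴸ h
  ·ᴸ-+ false d     = sym (trans (cong (_+ᴸ d ·ᴸ h) (·ᴸ-false h)) (+ᴸ-identityˡ (d ·ᴸ h)))
  ·ᴸ-+ true  false = sym (trans (cong (true ·ᴸ h +ᴸ_) (·ᴸ-false h)) (+ᴸ-identityʳ (true ·ᴸ h)))
  ·ᴸ-+ true  true  = trans (·ᴸ-false h) (sym (+ᴸ-self (true ·ᴸ h)))
  interchange : ∀ p q r s → (p +ᴸ q) +ᴸ (r +ᴸ s) ≡ (p +ᴸ r) +ᴸ (q +ᴸ s)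
  interchange p q r s = begin
    (p +ᴸ q) +ᴸ (r +ᴸ s) ≡⟨ +ᴸ-assoc p q _ ⟩
    p +ᴸ (q +ᴸ (r +ᴸ s)) ≡⟨ cong (p +ᴸ_) (sym (+ᴸ-assoc q r s)) ⟩
    p +ᴸ ((q +ᴸ r) +ᴸ s) ≡⟨ cong (λ x → p +ᴸ (x +ᴸ s)) (+ᴸ-comm q r) ⟩
    p +ᴸ ((r +ᴸ q) +ᴸ s) ≡⟨ cong (p +ᴸ_) (+ᴸ-assoc r q s) ⟩
    p +ᴸ (r +ᴸ (q +ᴸ s)) ≡⟨ sym (+ᴸ-assoc p r _) ⟩
    (p +ᴸ r) +ᴸ (q +ᴸ s) ∎
    where open ≡-Reasoning

span-∷ : (f : 𝕃 n) {L : List (𝕃 n)} → Span L ⇒ Span (f ∷ L)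
span-∷ f {L} (cs , refl) =
  false ∷ cs , trans (cong (_+ᴸ lincomb L cs) (·ᴸ-false f)) (+ᴸ-identityˡ (lincomb L cs))

span-∈ : {L : List (𝕃 n)} {f : 𝕃 n} → f ∈ L → Span L f
span-∈ {L = f ∷ L} (here refl) =
  let cs , e = span-0 L in
  true ∷ cs , trans (cong₂ _+ᴸ_ (·ᴸ-true f) e) (+ᴸ-identityʳ f)
span-∈ {L = f ∷ L} (there g∈L) = span-∷ f (span-∈ g∈L)

span-∷⁻ : {f : 𝕃 n} {L : List (𝕃 n)} {g : 𝕃 n} → Span (f ∷ L) g → Span L g ⊎ Span L (f +ᴸ g)
span-∷⁻ {f = f} {L} (false ∷ cs , refl) =
  inj₁ (cs , sym (trans (cong (_+ᴸ lincomb L cs) (·ᴸ-false f)) (+ᴸ-identityˡ (lincomb L cs))))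
span-∷⁻ {f = f} {L} (true ∷ cs , refl)  =
  inj₂ (cs , sym (trans (cong (λ x → f +ᴸ (x +ᴸ lincomb L cs)) (·ᴸ-true f))
                        (+ᴸ-cancelˡ f (lincomb L cs))))

span-least : {L M : List (𝕃 n)} → All (Span M) L → Span L ⇒ Span M
span-least {M = M} = span-closed (Span M) (span-0 M) (span-+ M)

span-zero : {L : List (𝕃 n)} {f : 𝕃 n} {a : Assignment n} → Span L f → Zero L a → ⟦ f ⟧ a ≡ false
span-zero {a = a} f∈ z = span-closed (λ f → ⟦ f ⟧ a ≡ false) (⟦0⟧ a)
  (λ {f} {g} p q → trans (⟦⟧-+ f g a) (cong₂ _xor_ p q)) z f∈

-- Consistency of linear systems over 𝔽₂

module _ {m : ℕ} where

  private
    leading : 𝕃 (suc m) → Bool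
    leading (linear c (b ∷ bs)) = b

    restrict : 𝕃 (suc m) → 𝕃 m
    restrict (linear c (b ∷ bs)) = linear c bs

    extend : 𝕃 m → 𝕃 (suc m)
    extend (linear c bs) = linear c (false ∷ bs)

    restrict-+ : ∀ f g → restrict (f +ᴸ g) ≡ restrict f +ᴸ restrict g
    restrict-+ (linear c (b ∷ bs)) (linear d (e ∷ es)) = refl

    leading-+ : ∀ f g → leading (f +ᴸ g) ≡ leading f xor leading g
    leading-+ (linear c (b ∷ bs)) (linear d (e ∷ es)) = refl

    extend-restrict : ∀ f → leading f ≡ false → extend (restrict f) ≡ f
    extend-restrict (linear c (b ∷ bs)) refl = refl

    ⟦⟧-∷ : ∀ f b a → ⟦ f ⟧ (b ∷ a) ≡ ⟦ restrict f ⟧ a xor (b ∧ leading f)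
    ⟦⟧-∷ (linear c (e ∷ es)) b a = cong (λ x → ⟦ linear c es ⟧ a xor (b ∧ x)) (eval-constᴮ e a)

  -- Carries a certificate of inconsistency back from fewer variables, as `extend 1ᴸ` computes to
  -- `1ᴸ`.
  span-extend : (M : List (𝕃 (suc m))) {N : List (𝕃 m)} →
                All (Span M ∘ extend) N → ∀ {f} → Span N f → Span M (extend f)
  span-extend M = span-closed (Span M ∘ extend) (span-0 M) (span-+ M)

  -- The first variable is eliminated: if it occurs in f ∈ M, then a zero of
  -- the other elements of M, cleared of it by f, determines its value.
  eliminate : (∀ N → ∃ (Zero N) ⊎ Span N 1ᴸ) → (M : List (𝕃 (suc m))) → ∃ (Zero M) ⊎ Span M 1ᴸ
  eliminate IH M with All.search (λ f → leading f Bool.≟ true) M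
  ... | inj₁ none = Sum.map
          -- The first variable occurs nowhere in `M`, so its value is arbitrary.
          (λ (a , z) → false ∷ a , All.tabulate λ {f} f∈M →
            trans (⟦⟧-∷ f false a)
              (trans (Bool.xor-identityʳ _) (All.lookup z (∈-map⁺ restrict f∈M))))
          (span-extend M (All.map⁺ (All.tabulate λ {f} f∈M →
            subst (Span M)
              (sym (extend-restrict f (Bool.¬-not (All.lookup none f∈M))))
              (span-∈ f∈M))))
          (IH (map restrict M))
  ... | inj₂ some with p , p∈M , lp ← find some =
          Sum.map
            -- `p` is the first variable plus `restrict p`, so it vanishes exactly if that variable
            -- takes the value of `restrict p`.
            (λ (a , z) → ⟦ restrict p ⟧ a ∷ a , All.tabulate λ {f} f∈M →
              vanish f a (All.lookup z (∈-map⁺ _ f∈M)))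
            (span-extend M (All.map⁺ (All.tabulate λ {f} f∈M →
              subst (Span M) (sym (extend-restrict (clear f) (clear-leading f))) (clear-span f f∈M))))
            (IH (map (restrict ∘ clear) M))
    where
    -- The pivot `p` itself is cleared to p + p = 0 and imposes no condition on the other variables.
    clear : 𝕃 (suc m) → 𝕃 (suc m)
    clear f = if leading f then p +ᴸ f else f

    clear-leading : ∀ f → leading (clear f) ≡ false
    clear-leading f with leading f in e
    ... | false = e
    ... | true  = trans (leading-+ p f) (cong₂ _xor_ lp e)

    clear-span : ∀ f → f ∈ M → Span M (clear f)
    clear-span f f∈M with leading f
    ... | false = span-∈ f∈M
    ... | true  = span-+ M (span-∈ p∈M) (span-∈ f∈M)

    vanish : ∀ f a → ⟦ restrict (clear f) ⟧ a ≡ false → ⟦ f ⟧ (⟦ restrict p ⟧ a ∷ a) ≡ false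
    vanish f a e rewrite ⟦⟧-∷ f (⟦ restrict p ⟧ a) a with leading f
    ... | false = trans (cong (⟦ restrict f ⟧ a xor_) (Bool.∧-zeroʳ _))
                    (trans (Bool.xor-identityʳ _) e)
    ... | true  =
      trans (cong (⟦ restrict f ⟧ a xor_) (trans (Bool.∧-identityʳ _)
              (⟦+⟧≡0⇒≡ (restrict p) (restrict f) a
                (trans (cong (λ g → ⟦ g ⟧ a) (sym (restrict-+ p f))) e))))
            (Bool.xor-same (⟦ restrict f ⟧ a))

-- The alternative is effective: eliminating one variable after the other ends with constants, and a
-- zero exists unless one of them is 1.
linear-nullstellensatz : (M : List (𝕃 n)) → ∃ (Zero M) ⊎ Span M 1ᴸ
linear-nullstellensatz {zero}  M with All.search (_≟ᴸ 1ᴸ) M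
... | inj₁ no1   = inj₁ ([] , All.map
  (λ { {linear c []} f≢1 → Bool.¬-not (f≢1 ∘ cong (λ c → linear c [])) }) no1)
... | inj₂ has1 with f , f∈M , refl ← find has1 = inj₂ (span-∈ f∈M)
linear-nullstellensatz {suc n} M = eliminate linear-nullstellensatz M
-- Finite sets

count : {P : Pred A 0ℓ} → Decidable P → List A → ℕ
count P? xs = length (filter P? xs)

module _ {P Q : Pred A 0ℓ} (P? : Decidable P) (Q? : Decidable Q) (P⇒Q : P ⇒ Q) where

  count-mono-≤ : ∀ xs → count P? xs ≤ count Q? xs
  count-mono-≤ []       = z≤n
  count-mono-≤ (x ∷ xs) with P? x | Q? x
  ... | yes _ | yes _ = s≤s (count-mono-≤ xs)
  ... | yes p | no ¬q = contradiction (P⇒Q p) ¬q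
  ... | no  _ | yes _ = ℕ.m≤n⇒m≤1+n (count-mono-≤ xs)
  ... | no  _ | no  _ = count-mono-≤ xs

  count-mono-< : ∀ {x xs} → x ∈ xs → Q x → ¬ P x → count P? xs < count Q? xs
  count-mono-< {xs = y ∷ xs} (here refl) q ¬p with P? y | Q? y
  ... | yes p | _     = contradiction p ¬p
  ... | no  _ | yes _ = s≤s (count-mono-≤ xs)
  ... | no  _ | no ¬q = contradiction q ¬q
  count-mono-< {xs = y ∷ xs} (there x∈xs) q ¬p with P? y | Q? y
  ... | yes _ | yes _ = s≤s (count-mono-< x∈xs q ¬p)
  ... | yes p | no ¬q = contradiction (P⇒Q p) ¬q
  ... | no  _ | yes _ = ℕ.m<n⇒m<1+n (count-mono-< x∈xs q ¬p)
  ... | no  _ | no  _ = count-mono-< x∈xs q ¬p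

-- Serves leading terms, compared by exponents, as well as the heuristics, compared by numbers of
-- paths or lengths. The maximum is taken over `xs` only, so callers supply a list that exhausts
-- `P`.
maximum : (O : TotalOrder 0ℓ 0ℓ 0ℓ) (f : A → TotalOrder.Carrier O) {P : Pred A 0ℓ} →
          Decidable P → ∀ xs →
          (∀ {x} → x ∈ xs → ¬ P x) ⊎
          ∃ λ m → P m × (∀ {x} → x ∈ xs → P x → TotalOrder._≤_ O (f x) (f m))
maximum O f P? xs with filter P? xs in eq
... | []     = inj₁ λ x∈xs px → case subst (_ ∈_) eq (∈-filter⁺ P? x∈xs px) of λ ()
... | y ∷ ys = inj₂ (argmax f y ys , proj₂ (∈-filter⁻ P? {xs = xs} (subst (_ ∈_) (sym eq) m∈)) ,
    λ x∈xs px → All.lookup (f[⊥]≤f[argmax] {f = f} y ys ∷ f[xs]≤f[argmax] {f = f} y ys)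
                  (subst (_ ∈_) eq (∈-filter⁺ P? x∈xs px)))
  where
  open Data.List.Extrema O
  m∈ : argmax f y ys ∈ y ∷ ys
  m∈ = [ here , there ]′ (argmax-sel f y ys)

-- All assignments and, since `Subset n` is `Vec Bool n`, also all square-free terms.
vecs : ∀ n → List (Vec Bool n)
vecs zero    = [] ∷ []
vecs (suc n) = map (true ∷_) (vecs n) ++ map (false ∷_) (vecs n)

∈-vecs : (v : Vec Bool n) → v ∈ vecs n
∈-vecs []          = here refl
∈-vecs (true  ∷ v) = ∈-++⁺ˡ (∈-map⁺ (true ∷_) (∈-vecs v))
∈-vecs (false ∷ v) = ∈-++⁺ʳ _ (∈-map⁺ (false ∷_) (∈-vecs v))

-- Leading terms

coeff-constᴮ : (c : Bool) (t : Subset n) → coeff (constᴮ c) t ≡ true → t ≡ ⊥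
coeff-constᴮ c []            e = refl
coeff-constᴮ c (outside ∷ t) e = cong (outside ∷_) (coeff-constᴮ c t e)
coeff-constᴮ c (inside  ∷ t) e = contradiction (trans (sym (coeff-0 t)) e) λ ()

linear-support : (f : 𝕃 n) (t : Subset n) → coeff (ι f) t ≡ true → t ≡ ⊥ ⊎ ∃ λ i → t ≡ ⁅ i ⁆
linear-support (linear c [])       []            e = inj₁ refl
linear-support (linear c (b ∷ bs)) (outside ∷ t) e =
  Sum.map (cong (outside ∷_)) (λ (i , e) → suc i , cong (outside ∷_) e)
    (linear-support (linear c bs) t e)
linear-support (linear c (b ∷ bs)) (inside ∷ t)  e =
  inj₂ (zero , cong (inside ∷_) (coeff-constᴮ b t e))

term-⊥ : term {n} ⊥ ≡ constᴮ true
term-⊥ {zero}  = refl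
term-⊥ {suc n} = cong (_+x· 0ᴮ) term-⊥

ι-1 : ι 1ᴸ ≡ term {n} ⊥
ι-1 = trans (ι-linear-replicate true) (sym term-⊥)

ι-x : (i : Fin n) → ι (xᴸ i) ≡ term ⁅ i ⁆
ι-x zero    = cong₂ _+x·_ ι-0 (sym term-⊥)
ι-x (suc i) = cong₂ _+x·_ (ι-x i) constᴮ-false

-- Terms of linear polynomials are linear, so moving one into a remainder does not lead out of `𝕃`.
linear-support-term : (f : 𝕃 n) (t : Subset n) → coeff (ι f) t ≡ true → ∃ λ m → ι m ≡ term t
linear-support-term f t e with linear-support f t e
... | inj₁ refl       = 1ᴸ , ι-1
... | inj₂ (i , refl) = xᴸ i , ι-x i

⊆⊥⇒≡⊥ : {u : Subset n} → u ⊆ ⊥ → u ≡ ⊥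
⊆⊥⇒≡⊥ u⊆⊥ = Subset.⊆-antisym u⊆⊥ Subset.⊥⊆

linear-support-⊆ : (f g : 𝕃 n) (t u : Subset n) → coeff (ι f) t ≡ true → coeff (ι g) u ≡ true →
                   u ⊆ t → u ≡ t ⊎ u ≡ ⊥
linear-support-⊆ f g t u ft gu u⊆t with linear-support f t ft | linear-support g u gu
... | _               | inj₁ u≡⊥        = inj₂ u≡⊥
... | inj₁ refl       | _               = inj₁ (⊆⊥⇒≡⊥ u⊆t)
... | inj₂ (i , refl) | inj₂ (j , refl) =
  inj₁ (cong ⁅_⁆ (Subset.x∈⁅y⁆⇒x≡y i (u⊆t (Subset.x∈⁅x⁆ j))))

─-self : (t : Subset n) → t ─ t ≡ ⊥
─-self []            = refl
─-self (inside  ∷ t) = cong (outside ∷_) (─-self t)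
─-self (outside ∷ t) = cong (outside ∷_) (─-self t)

exponents-injective : {s t : Subset n} → exponents s ≡ exponents t → s ≡ t
exponents-injective {s = []}          {[]}          e = refl
exponents-injective {s = inside ∷ s}  {inside ∷ t}  e =
  cong (inside ∷_) (exponents-injective (Vec.∷-injectiveʳ e))
exponents-injective {s = outside ∷ s} {outside ∷ t} e =
  cong (outside ∷_) (exponents-injective (Vec.∷-injectiveʳ e))

exponents-⊥ : exponents {n} ⊥ ≡ replicate n 0
exponents-⊥ = Vec.map-replicate _ outside _

xor-true : ∀ b c → b xor c ≡ true → b ≡ true ⊎ c ≡ true
xor-true false c e = inj₂ e
xor-true true  c e = inj₁ refl

support-+ : (p q : 𝔹 n) (t : Subset n) → coeff (p +ᴮ q) t ≡ true →
            coeff p t ≡ true ⊎ coeff q t ≡ true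
support-+ p q t e = xor-true (coeff p t) (coeff q t) (trans (sym (coeff-+ p q t)) e)

module _ (σ : TermOrdering n) where

  open TermOrdering σ
  private
    module ≤ₜ = IsTotalOrder isTotalOrder

    infix 4 _<ₛ_ _<ₛ?_

    _<ₛ_ : Subset n → Subset n → Set
    s <ₛ t = exponents s ≤ₜ exponents t × s ≢ t

    _<ₛ?_ : ∀ s t → Dec (s <ₛ t)
    s <ₛ? t with Vec.≡-dec Bool._≟_ s t | ≤ₜ.total (exponents s) (exponents t)
    ... | yes s≡t | _        = no λ (_ , s≢t) → s≢t s≡t
    ... | no  s≢t | inj₁ s≤t = yes (s≤t , s≢t)
    ... | no  s≢t | inj₂ t≤s = no λ (s≤t , _) → s≢t (exponents-injective (≤ₜ.antisym s≤t t≤s))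

    -- The position of `t` among the finitely many square-free terms; it bounds the number of
    -- division steps.
    rank : Subset n → ℕ
    rank t = count (_<ₛ? t) (vecs n)

    rank-mono : ∀ {s t} → s <ₛ t → rank s < rank t
    rank-mono {s} {t} (s≤t , s≢t) =
      count-mono-< (_<ₛ? s) (_<ₛ? t)
        (λ (u≤s , u≢s) → ≤ₜ.trans u≤s s≤t ,
           λ { refl → u≢s (exponents-injective (≤ₜ.antisym u≤s s≤t)) })
        (∈-vecs s) (s≤t , s≢t) (λ (_ , s≢s) → s≢s refl)

  ¬IsLT-0 : ∀ {t} → ¬ IsLT σ 0ᴮ t
  ¬IsLT-0 {t} lt = contradiction (trans (sym (coeff-0 t)) (IsLT.inSupport lt)) λ ()

  leadingTerm : (p : 𝔹 n) → p ≡ 0ᴮ ⊎ ∃ (IsLT σ p)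
  leadingTerm p =
    Sum.map
      (λ none → coeff-injective-0 p λ t → Bool.¬-not (none (∈-vecs t)))
      (λ (t , ct , max) → t , record { inSupport = ct ; largest = λ u → max (∈-vecs u) })
      (maximum (record { isTotalOrder = isTotalOrder }) exponents
        (λ t → coeff p t Bool.≟ true) (vecs n))

  IsLT-unique : ∀ {p s t} → IsLT σ p s → IsLT σ p t → s ≡ t
  IsLT-unique l m = exponents-injective (≤ₜ.antisym
    (IsLT.largest m _ (IsLT.inSupport l)) (IsLT.largest l _ (IsLT.inSupport m)))

  IsLT? : ∀ p t → Dec (IsLT σ p t)
  IsLT? p t with leadingTerm p
  ... | inj₁ refl    = no ¬IsLT-0
  ... | inj₂ (u , l) = map′ (λ { refl → l }) (IsLT-unique l) (Vec.≡-dec Bool._≟_ u t)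

  IsLT-term : ∀ t → IsLT σ (term t) t
  IsLT-term t = record
    { inSupport = coeff-term t
    ; largest   = λ u e → ≤ₜ.reflexive (cong exponents (term-support t u e)) }

  -- Over 𝔽₂ both leading coefficients are 1, so they cancel.
  cancel-IsLT : ∀ {p q t u} → IsLT σ p t → IsLT σ q t → coeff (p +ᴮ q) u ≡ true → u <ₛ t
  cancel-IsLT {p} {q} {t} {u} l m e =
    [ IsLT.largest l u , IsLT.largest m u ]′ (support-+ p q u e) ,
    λ { refl → contradiction
          (trans (sym e) (trans (coeff-+ p q t) (cong₂ _xor_ (IsLT.inSupport l) (IsLT.inSupport m))))
          λ () }

  IsLT-+ : ∀ {p q s t} → IsLT σ p s → IsLT σ q t → s <ₛ t → IsLT σ (p +ᴮ q) t
  IsLT-+ {p} {q} {s} {t} l m (s≤t , s≢t) = record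
    { inSupport = trans (coeff-+ p q t) (cong₂ _xor_
        (Bool.¬-not λ pt → s≢t (exponents-injective (≤ₜ.antisym s≤t (IsLT.largest l t pt))))
        (IsLT.inSupport m))
    ; largest   = λ u e →
        [ (λ pu → ≤ₜ.trans (IsLT.largest l u pu) s≤t) , IsLT.largest m u ]′ (support-+ p q u e) }

  IsLT-+ʳ : ∀ {p q s t} → IsLT σ p s → IsLT σ q t → s <ₛ t → IsLT σ (q +ᴮ p) t
  IsLT-+ʳ {p} {q} {s} {t} l m (s≤t , s≢t) = record
    { inSupport = trans (coeff-+ q p t) (cong₂ _xor_ (IsLT.inSupport m)
        (Bool.¬-not λ pt → s≢t (exponents-injective (≤ₜ.antisym s≤t (IsLT.largest l t pt)))))
    ; largest   = λ u e →
        [ IsLT.largest m u , (λ pu → ≤ₜ.trans (IsLT.largest l u pu) s≤t) ]′ (support-+ q p u e) }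

  -- The term 1 is the least one, so after cancelling it nothing can be left of `g`.
  IsLT-⊥ : (g : 𝕃 n) → IsLT σ (ι g) ⊥ → g ≡ 1ᴸ
  IsLT-⊥ g l = +ᴸ≡0⇒≡ (ι-injective _ _ (trans (trans (ι-+ g 1ᴸ) (cong (ι g +ᴮ_) ι-1))
    (trans (coeff-injective-0 _ λ t → Bool.¬-not λ e →
      let t≤⊥ , t≢⊥ = cancel-IsLT l (IsLT-term ⊥) e in
      t≢⊥ (exponents-injective (≤ₜ.antisym t≤⊥
        (subst (_≤ₜ exponents t) (sym exponents-⊥) (1-minimum (exponents t))))))
    (sym ι-0))))

  IsLT-1 : IsLT σ (ι 1ᴸ) ⊥
  IsLT-1 = subst (λ p → IsLT σ p ⊥) (sym ι-1) (IsLT-term ⊥)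

  private
    -- A bound on the whole support also makes sense for the zero polynomial, which has no leading
    -- term.
    RankBelow : ℕ → Pred (𝕃 n) 0ℓ
    RankBelow k f = ∀ t → coeff (ι f) t ≡ true → rank t < k

    rankBelow : ∀ f → ∃ λ k → RankBelow k f
    rankBelow f with leadingTerm (ι f)
    ... | inj₁ f≡0     = 0 , λ t e → contradiction
      (trans (sym (coeff-0 t)) (trans (cong (λ p → coeff p t) (sym f≡0)) e)) λ ()
    ... | inj₂ (t , l) = suc (rank t) , λ u e → s≤s (below u e)
      where
      below : ∀ u → coeff (ι f) u ≡ true → rank u ≤ rank t
      below u e with Vec.≡-dec Bool._≟_ u t
      ... | yes refl = ℕ.≤-refl
      ... | no  u≢t  = ℕ.<⇒≤ (rank-mono (IsLT.largest l u e , u≢t))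

    rankBelow-+ : ∀ {k f m t} → RankBelow (suc k) f → IsLT σ (ι f) t → IsLT σ (ι m) t →
                  RankBelow k (f +ᴸ m)
    rankBelow-+ {k} {f} {m} {t} below l l′ u e = ℕ.<-≤-trans
      (rank-mono (cancel-IsLT l l′ (trans (cong (λ p → coeff p u) (sym (ι-+ f m))) e)))
      (s≤s⁻¹ (below t (IsLT.inSupport l)))

  -- Division

  -- As a condition on the whole support it is closed under sums, which a condition on the leading
  -- term alone would not be.
  Reduced : List (𝕃 n) → Pred (𝕃 n) 0ℓ
  Reduced L f = ∀ {t g u} → coeff (ι f) t ≡ true → g ∈ L → IsLT σ (ι g) u → ¬ u ⊆ t

  reduced-+ : ∀ {L f g} → Reduced L f → Reduced L g → Reduced L (f +ᴸ g)
  reduced-+ {f = f} {g} rf rg {t} e h∈L l =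
    [ (λ ft → rf ft h∈L l) , (λ gt → rg gt h∈L l) ]′
      (support-+ (ι f) (ι g) t (trans (cong (λ p → coeff p t) (sym (ι-+ f g))) e))

  -- Only the term 1 divides 1, and an element with leading term 1 is the constant 1, which has no
  -- zero.
  reduced-1 : ∀ {L a} → Zero L a → Reduced L 1ᴸ
  reduced-1 {a = a} z {t} {g} {u} e g∈L l u⊆t
    with term-support ⊥ t (trans (cong (λ p → coeff p t) (sym ι-1)) e)
  ... | refl with ⊆⊥⇒≡⊥ u⊆t
  ... | refl = contradiction (trans (sym (⟦1⟧ a))
                 (trans (cong (λ f → ⟦ f ⟧ a) (sym (IsLT-⊥ g l))) (All.lookup z g∈L))) λ ()

  -- Whether the leading term is reduced or kept, the step adds a linear `m` with that same leading
  -- term. So the rank drops and the intermediate polynomials stay in the image of `ι`.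
  NR-exists : ∀ L f → ∃ λ f′ → NR σ (map ι L) (ι f) (ι f′)
  NR-exists L f = let k , below = rankBelow f in go k f below
    where
    Divisor : Subset n → Pred (𝕃 n) 0ℓ
    Divisor t g = ∃ λ u → IsLT σ (ι g) u × u ⊆ t

    divisor? : ∀ t → Decidable (Divisor t)
    divisor? t g with leadingTerm (ι g)
    ... | inj₁ g≡0     = no λ (u , l , _) → ¬IsLT-0 (subst (λ p → IsLT σ p u) g≡0 l)
    ... | inj₂ (u , l) with u Subset.⊆? t
    ...   | yes u⊆t = yes (u , l , u⊆t)
    ...   | no  u⊈t = no λ (v , m , v⊆t) → u⊈t (subst (_⊆ t) (IsLT-unique m l) v⊆t)

    -- A divisor of a linear term is the term itself or 1.
    quotient : ∀ f g {t u} → IsLT σ (ι f) t → IsLT σ (ι g) u → u ⊆ t →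
               ∃ λ m → ι m ≡ term (t ─ u) *ᴮ ι g × IsLT σ (ι m) t
    quotient f g {t} {u} l l′ u⊆t
      with linear-support-⊆ f g t u (IsLT.inSupport l) (IsLT.inSupport l′) u⊆t
    ... | inj₁ refl = g , sym (trans (cong (λ s → term s *ᴮ ι g) (─-self t))
                                (trans (cong (_*ᴮ ι g) term-⊥) (*ᴮ-identityˡ (ι g)))) , l′
    ... | inj₂ refl with linear-support-term f t (IsLT.inSupport l) | IsLT-⊥ g l′
    ...   | m , e | refl = m , trans e (sym (trans
              (cong₂ _*ᴮ_ (cong term (Subset.p─⊥≡p t)) (trans ι-1 term-⊥))
              (*ᴮ-identityʳ (term t)))) , subst (λ p → IsLT σ p t) (sym e) (IsLT-term t)

    go : ∀ k f → RankBelow k f → ∃ λ f′ → NR σ (map ι L) (ι f) (ι f′)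
    go k f below with leadingTerm (ι f)
    ... | inj₁ f≡0 = 0ᴸ , subst₂ (NR σ (map ι L)) (sym f≡0) (sym ι-0) done
    go zero    f below | inj₂ (t , l) = contradiction (below t (IsLT.inSupport l)) λ ()
    go (suc k) f below | inj₂ (t , l) with Any.any? (divisor? t) L
    ... | yes some =
      let g , g∈L , u , l′ , u⊆t = find some
          m , e , lm = quotient f g l l′ u⊆t
          f′ , nr = go k (f +ᴸ m) (rankBelow-+ {f = f} below l lm)
      in f′ , reduce l (∈-map⁺ ι g∈L) l′ u⊆t
           (subst (λ p → NR σ (map ι L) p (ι f′)) (trans (ι-+ f m) (cong (ι f +ᴮ_) e)) nr)
    ... | no none =
      let m , e = linear-support-term f t (IsLT.inSupport l)
          lm = subst (λ p → IsLT σ p t) (sym e) (IsLT-term t)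
          f′ , nr = go k (f +ᴸ m) (rankBelow-+ {f = f} below l lm)
      in m +ᴸ f′ , subst (NR σ (map ι L) (ι f)) (sym (trans (ι-+ m f′) (cong (_+ᴮ ι f′) e)))
           (keep l
             (λ g∈ l′ u⊆t → case ∈-map⁻ ι g∈ of λ { (g , g∈L , refl) → none (lose g∈L (_ , l′ , u⊆t)) })
             (subst (λ p → NR σ (map ι L) p (ι f′)) (trans (ι-+ f m) (cong (ι f +ᴮ_) e)) nr))

  -- A reduction adds a multiple of an element of `G`, which vanishes at `a`; a kept term only moves
  -- from `p` to the remainder.
  NR-eval : ∀ {G p r a} → NR σ G p r → (∀ {g} → g ∈ G → eval g a ≡ false) → eval p a ≡ eval r a
  NR-eval done z = refl
  NR-eval {a = a} (reduce {p} {r} {g} {t} {u} _ g∈G _ _ nr) z = begin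
    eval p a                                          ≡⟨ Bool.xor-identityʳ _ ⟨
    eval p a xor false                                ≡⟨ cong (eval p a xor_) (Bool.∧-zeroʳ _) ⟨
    eval p a xor (eval (term (t ─ u)) a ∧ false)      ≡⟨ cong (λ b → eval p a xor (eval (term (t ─ u)) a ∧ b))
                                                              (z g∈G) ⟨
    eval p a xor (eval (term (t ─ u)) a ∧ eval g a)   ≡⟨ cong (eval p a xor_) (eval-* (term (t ─ u)) g a) ⟨
    eval p a xor eval (term (t ─ u) *ᴮ g) a           ≡⟨ eval-+ p (term (t ─ u) *ᴮ g) a ⟨
    eval (p +ᴮ term (t ─ u) *ᴮ g) a                   ≡⟨ NR-eval nr z ⟩
    eval r a                                          ∎
    where open ≡-Reasoning
  NR-eval {a = a} (keep {p} {r} {t} _ _ nr) z = sym (begin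
    eval (term t +ᴮ r) a                      ≡⟨ eval-+ (term t) r a ⟩
    eval (term t) a xor eval r a              ≡⟨ cong (eval (term t) a xor_) (NR-eval nr z) ⟨
    eval (term t) a xor eval (p +ᴮ term t) a  ≡⟨ cong (eval (term t) a xor_) (eval-+ p (term t) a) ⟩
    eval (term t) a xor (eval p a xor eval (term t) a) ≡⟨ cong (eval (term t) a xor_)
                                                               (Bool.xor-comm (eval p a) _) ⟩
    eval (term t) a xor (eval (term t) a xor eval p a) ≡⟨ Bool.xor-assoc (eval (term t) a) _ _ ⟨
    (eval (term t) a xor eval (term t) a) xor eval p a ≡⟨ cong (_xor eval p a)
                                                               (Bool.xor-same (eval (term t) a)) ⟩
    eval p a                                  ∎)
    where open ≡-Reasoning

  NR-irreducible : ∀ {G p r} → NR σ G p r → ∀ {t g u} → coeff r t ≡ true → g ∈ G → IsLT σ g u → ¬ u ⊆ t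
  NR-irreducible done {t} e = contradiction (trans (sym (coeff-0 t)) e) λ ()
  NR-irreducible (reduce _ _ _ _ nr) = NR-irreducible nr
  NR-irreducible (keep {r = r} {s} l irr nr) {t} e with support-+ (term s) r t e
  ... | inj₂ rt = NR-irreducible nr rt
  ... | inj₁ st with term-support s t st
  ...   | refl  = irr

  DistinctLT : List (𝕃 n) → Set
  DistinctLT = AllPairs (λ f g → ∀ {t u} → IsLT σ (ι f) t → IsLT σ (ι g) u → t ≢ u)

  -- With distinct leading terms nothing cancels at the top. If f = h + b with b in the span of the
  -- other elements, then by induction the leading term of b is that of some g among them. It
  -- differs from that of h, and the larger of the two leads f.
  span-IsLT : ∀ {B f t} → DistinctLT B → Span B f → IsLT σ (ι f) t → ∃ λ g → g ∈ B × IsLT σ (ι g) t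
  span-IsLT {[]} [] ([] , refl) l = contradiction (subst (λ p → IsLT σ p _) ι-0 l) ¬IsLT-0
  span-IsLT {h ∷ B} {f} {t} (h# ∷ #) f∈ l with span-∷⁻ f∈
  ... | inj₁ f∈B = let g , g∈B , l′ = span-IsLT # f∈B l in g , there g∈B , l′
  ... | inj₂ b∈B with leadingTerm (ι (h +ᴸ f)) | leadingTerm (ι h)
  ...   | inj₁ b≡0 | _ = h , here refl ,
            subst (λ g → IsLT σ (ι g) t) (sym (+ᴸ≡0⇒≡ (ι-injective _ _ (trans b≡0 (sym ι-0))))) l
  -- `DistinctLT` does not exclude the zero polynomial, about which it says nothing.
  ...   | inj₂ (s , lb) | inj₁ h≡0 =
            let g , g∈B , l′ = span-IsLT # b∈B (subst (λ g → IsLT σ (ι g) t)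
                  (trans (sym (+ᴸ-identityˡ f)) (cong (_+ᴸ f) (sym (ι-injective _ _ (trans h≡0 (sym ι-0)))))) l)
            in g , there g∈B , l′
  ...   | inj₂ (s , lb) | inj₂ (u , lh) with span-IsLT # b∈B lb
  ...     | g , g∈B , lg with ≤ₜ.total (exponents u) (exponents s)
  ...       | inj₁ u≤s = g , there g∈B ,
                subst (IsLT σ (ι g)) (IsLT-unique (sum (IsLT-+ lh lb (u≤s , All.lookup h# g∈B lh lg))) l) lg
              where
              sum : ∀ {s} → IsLT σ (ι h +ᴮ ι (h +ᴸ f)) s → IsLT σ (ι f) s
              sum = subst (λ p → IsLT σ p _) (trans (sym (ι-+ h (h +ᴸ f))) (cong ι (+ᴸ-cancelˡ h f)))
  ...       | inj₂ s≤u = h , here refl ,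
                subst (IsLT σ (ι h)) (IsLT-unique (sum (IsLT-+ʳ lb lh
                  (s≤u , All.lookup h# g∈B lh lg ∘ sym))) l) lh
              where
              sum : ∀ {s} → IsLT σ (ι h +ᴮ ι (h +ᴸ f)) s → IsLT σ (ι f) s
              sum = subst (λ p → IsLT σ p _) (trans (sym (ι-+ h (h +ᴸ f))) (cong ι (+ᴸ-cancelˡ h f)))

  -- Otherwise (d + 1) ∷ B would have no zero, so that 1 or d were in the span
  -- of B, and the leading term of d would be a multiple of one of B.
  reduced-nonzero : ∀ {B d} → DistinctLT B → Reduced B d → d ≢ 0ᴸ → ∃ λ a → Zero B a × ⟦ d ⟧ a ≡ true
  reduced-nonzero {B} {d} # red d≢0 with leadingTerm (ι d)
  ... | inj₁ d≡0     = contradiction (ι-injective _ _ (trans d≡0 (sym ι-0))) d≢0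
  ... | inj₂ (t , l) with linear-nullstellensatz ((d +ᴸ 1ᴸ) ∷ B)
  ...   | inj₁ (a , e ∷ z) = a , z , Bool.not-injective (trans (sym (⟦+1⟧ d a)) e)
  ...   | inj₂ 1∈ with span-∷⁻ 1∈
  ...     | inj₁ 1∈B =
              let g , g∈B , l′ = span-IsLT # 1∈B IsLT-1
              in ⊥-elim (red (IsLT.inSupport l) g∈B l′ Subset.⊥⊆)
  ...     | inj₂ d∈B =
              let g , g∈B , l′ = span-IsLT # (subst (Span B) (+ᴸ-cancelʳ d 1ᴸ) d∈B) l
              in ⊥-elim (red (IsLT.inSupport l) g∈B l′ id)

  -- Elements are inserted one at a time: the head of `f` is reduced by the basis `B` of the rest
  -- until `f` vanishes, and `B` is kept, or until its leading term is new, and the result joins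
  -- `B`.
  reducedBasis : ∀ L → ∃ (IsReducedBasis σ L)
  reducedBasis []      = [] , record
    { independent = λ { [] _ → refl } ; spans = id , id ; distinctLT = [] }
  reducedBasis (f ∷ L) = let k , below = rankBelow f in extend (headReduce k f below)
    where
    B = proj₁ (reducedBasis L)
    module B = IsReducedBasis (proj₂ (reducedBasis L))

    HeadReduced : Pred (𝕃 n) 0ℓ
    HeadReduced f = f ≡ 0ᴸ ⊎ ∃ λ t → IsLT σ (ι f) t × (∀ {g} → g ∈ B → ¬ IsLT σ (ι g) t)

    headReduce : ∀ k f → RankBelow k f → ∃ λ h → Span B h × HeadReduced (f +ᴸ h)
    headReduce k f below with leadingTerm (ι f)
    ... | inj₁ f≡0 = 0ᴸ , span-0 B ,
            inj₁ (trans (+ᴸ-identityʳ f) (ι-injective _ _ (trans f≡0 (sym ι-0))))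
    headReduce zero    f below | inj₂ (t , l) = contradiction (below t (IsLT.inSupport l)) λ ()
    headReduce (suc k) f below | inj₂ (t , l) with Any.any? (λ g → IsLT? (ι g) t) B
    ... | no none = 0ᴸ , span-0 B ,
            inj₂ (t , subst (λ g → IsLT σ (ι g) t) (sym (+ᴸ-identityʳ f)) l ,
                  λ g∈B lg → none (lose g∈B lg))
    ... | yes some =
            let g , g∈B , lg = find some
                h , h∈B , hr = headReduce k (f +ᴸ g) (rankBelow-+ {f = f} below l lg)
            in g +ᴸ h , span-+ B (span-∈ g∈B) h∈B , subst HeadReduced (+ᴸ-assoc f g h) hr

    extend : (∃ λ h → Span B h × HeadReduced (f +ᴸ h)) → ∃ (IsReducedBasis σ (f ∷ L))
    extend (h , h∈B , inj₁ f+h≡0) = B , record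
      { independent = B.independent
      ; spans       = span-∷ f ∘ proj₁ B.spans ,
                      span-least (subst (Span B) (sym (+ᴸ≡0⇒≡ f+h≡0)) h∈B ∷
                                  All.tabulate (proj₂ B.spans ∘ span-∈))
      ; distinctLT  = B.distinctLT }
    extend (h , h∈B , inj₂ (t , l , new)) = f′ ∷ B , record
      { independent = independent
      ; spans       = span-least (span-+ (f ∷ L) (span-∈ (here refl)) (span-∷ f (proj₁ B.spans h∈B)) ∷
                                  All.tabulate (span-∷ f ∘ proj₁ B.spans ∘ span-∈)) ,
                      span-least (subst (Span (f′ ∷ B)) (+ᴸ-cancelʳ f h)
                                    (span-+ (f′ ∷ B) (span-∈ (here refl)) (span-∷ f′ h∈B)) ∷
                                  All.tabulate (span-∷ f′ ∘ proj₂ B.spans ∘ span-∈))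
      ; distinctLT  = All.tabulate (λ g∈B l′ lg t≡u →
                        new g∈B (subst (IsLT σ _) (trans (sym t≡u) (IsLT-unique l′ l)) lg)) ∷ B.distinctLT }
      where
      f′ = f +ᴸ h
      independent : LinearlyIndependent (f′ ∷ B)
      independent (false ∷ cs) e = cong (false ∷_) (B.independent cs
        (trans (sym (trans (cong (_+ᴸ lincomb B cs) (·ᴸ-false f′)) (+ᴸ-identityˡ (lincomb B cs)))) e))
      -- Coefficient 1 would put `f′` into the span of `B`, where its leading term does not occur.
      independent (true ∷ cs)  e =
        let g , g∈B , lg = span-IsLT B.distinctLT (cs , sym (trans (sym (·ᴸ-true f′)) (+ᴸ≡0⇒≡ e))) l
        in contradiction lg (new g∈B)
-- Counting

module _ {A B : Set} (R : A → B → Set) where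

  -- No two elements of `xs` share a hole. `R` is a relation rather than a function, because the
  -- holes of components are components again, given as lists only up to order.
  pigeonhole : ∀ {xs ys} → AllPairs (λ x x′ → ∀ y → R x y → ¬ R x′ y) xs →
               (∀ {x} → x ∈ xs → ∃ λ y → y ∈ ys × R x y) → length xs ≤ length ys
  pigeonhole {[]}     []         h = z≤n
  pigeonhole {x ∷ xs} (x# ∷ xs#) h with h (here refl)
  ... | y , y∈ , rxy with ∈-∃++ y∈
  ... | as , bs , refl = subst (suc (length xs) ≤_) (sym length-split) (s≤s (pigeonhole xs# rest))
    where
    length-split : length (as ++ y ∷ bs) ≡ suc (length (as ++ bs))
    length-split = trans (List.length-++ as) (trans (ℕ.+-suc _ _) (cong suc (sym (List.length-++ as))))
    rest : ∀ {x′} → x′ ∈ xs → ∃ λ y′ → y′ ∈ as ++ bs × R x′ y′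
    rest x′∈ with h (there x′∈)
    ... | y′ , y′∈ , r with ∈-++⁻ as y′∈
    ...   | inj₁ y′∈as         = y′ , ∈-++⁺ˡ y′∈as , r
    ...   | inj₂ (here refl)   = contradiction r (All.lookup x# x′∈ y′ rxy)
    ...   | inj₂ (there y′∈bs) = y′ , ∈-++⁺ʳ as y′∈bs , r

Unique⇒length-≤ : {xs ys : List A} → Unique xs → (∀ {x} → x ∈ xs → x ∈ ys) → length xs ≤ length ys
Unique⇒length-≤ u xs⊆ys =
  pigeonhole _≡_ (AllPairs.map (λ x≢x′ y x≡y x′≡y → x≢x′ (trans x≡y (sym x′≡y))) u)
    (λ x∈ → _ , xs⊆ys x∈ , refl)

HasSize-unique : {P : Pred A 0ℓ} {k l : ℕ} → HasSize P k → HasSize P l → k ≡ l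
HasSize-unique (xs , xs! , xs⇔ , refl) (ys , ys! , ys⇔ , refl) = ℕ.≤-antisym
  (Unique⇒length-≤ xs! λ x∈ → Equivalence.from (ys⇔ _) (Equivalence.to (xs⇔ _) x∈))
  (Unique⇒length-≤ ys! λ y∈ → Equivalence.from (xs⇔ _) (Equivalence.to (ys⇔ _) y∈))

hasSize : DecidableEquality A → {P : Pred A 0ℓ} → Decidable P →
          (ys : List A) → P ⇒ (_∈ ys) → ∃ (HasSize P)
hasSize _≟_ P? ys P⇒∈ = _ , deduplicate _≟_ (filter P? ys) , deduplicate-! _≟_ (filter P? ys) ,
  (λ x → mk⇔ (λ x∈ → proj₂ (∈-filter⁻ P? {xs = ys} (∈-deduplicate⁻ _≟_ (filter P? ys) x∈)))
             (λ px → ∈-deduplicate⁺ _≟_ (∈-filter⁺ P? (P⇒∈ px) px))) , refl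

listsUpTo : List A → ℕ → List (List A)
listsUpTo V zero    = [] ∷ []
listsUpTo V (suc k) = [] ∷ cartesianProductWith _∷_ V (listsUpTo V k)

∈-listsUpTo : {V : List A} (k : ℕ) {xs : List A} → (∀ {x} → x ∈ xs → x ∈ V) →
              length xs ≤ k → xs ∈ listsUpTo V k
∈-listsUpTo zero    {[]}     ⊆V l = here refl
∈-listsUpTo (suc k) {[]}     ⊆V l = here refl
∈-listsUpTo (suc k) {x ∷ xs} ⊆V (s≤s l) =
  there (∈-cartesianProductWith⁺ _∷_ (⊆V (here refl)) (∈-listsUpTo k (⊆V ∘ there) l))

count-partition : {P Q : Pred A 0ℓ} (P? : Decidable P) (Q? : Decidable Q) →
                  (∀ {x} → P x → ¬ Q x) → (∀ {x} → ¬ P x → Q x) →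
                  ∀ xs → length xs ≡ count P? xs + count Q? xs
count-partition P? Q? disjoint cover [] = refl
count-partition P? Q? disjoint cover (x ∷ xs) with P? x | Q? x
... | yes p | yes q = contradiction q (disjoint p)
... | yes p | no  _ = cong suc (count-partition P? Q? disjoint cover xs)
... | no  _ | yes _ = trans (cong suc (count-partition P? Q? disjoint cover xs)) (sym (ℕ.+-suc _ _))
... | no ¬p | no ¬q = contradiction (cover ¬p) ¬q

-- The partner relation exchanges the elements of value true and false.
partners⇒even : {R : A → A → Set} (value : A → Bool) {xs : List A} →
                AllPairs (λ x x′ → ∀ y → R x y → ¬ R x′ y) xs →
                (∀ {x} → x ∈ xs → ∃ λ y → y ∈ xs × R x y × value y ≡ not (value x)) →
                2 ∣ length xs
partners⇒even {R = R} value {xs} R# partner = divides (count (value? true) xs) (begin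
  length xs
    ≡⟨ count-partition (value? true) (value? false) (λ t f → case trans (sym t) f of λ ()) Bool.¬-not xs ⟩
  count (value? true) xs + count (value? false) xs
    ≡⟨ cong (count (value? true) xs +_) (ℕ.≤-antisym (exchange false) (exchange true)) ⟩
  count (value? true) xs + count (value? true) xs
    ≡⟨ cong (count (value? true) xs +_) (ℕ.+-identityʳ _) ⟨
  2 * count (value? true) xs
    ≡⟨ ℕ.*-comm 2 (count (value? true) xs) ⟩
  count (value? true) xs * 2 ∎)
  where
  open ≡-Reasoning
  value? : ∀ b → Decidable (λ x → value x ≡ b)
  value? b x = value x Bool.≟ b
  exchange : ∀ b → count (value? b) xs ≤ count (value? (not b)) xs
  -- Partners inject the elements of value `b` into those of the other value; both directions
  -- together make the two counts equal.
  exchange b = pigeonhole R (AllPairs.filter⁺ (value? b) R#) λ x∈ →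
    let x∈xs , vx = ∈-filter⁻ (value? b) {xs = xs} x∈
        y , y∈xs , r , vy = partner x∈xs
    in y , ∈-filter⁺ (value? (not b)) y∈xs (trans vy (cong not vx)) , r

-- Paths

_∈?_ : (f : 𝕃 n) (L : List (𝕃 n)) → Dec (f ∈ L)
f ∈? L = Any.any? (f ≟ᴸ_) L

EdgeSound : List (𝕃 n × 𝕃 n) → Pred (Assignment n) 0ℓ
EdgeSound E a = ∀ {f g} → (f , g) ∈ E → ⟦ f ⟧ a ≡ false → ⟦ g ⟧ a ≡ false

-- Contraposition of implications: the condition of an implication graph structure with f + 1
-- substituted for f.
Skew : List (𝕃 n × 𝕃 n) → Set
Skew E = ∀ {f g} → (f , g) ∈ E → (g +ᴸ 1ᴸ , f +ᴸ 1ᴸ) ∈ E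

≡-from-false : {b c : Bool} → (b ≡ false → c ≡ false) → (c ≡ false → b ≡ false) → b ≡ c
≡-from-false {false} {c}     h k = sym (h refl)
≡-from-false {true}  {false} h k = k refl
≡-from-false {true}  {true}  h k = refl

module Paths (G : Graph n)
             (E⊆V² : ∀ {f g} → (f , g) ∈ Graph.E G → f ∈ Graph.V G × g ∈ Graph.V G) where

  open Graph G

  edge? : (e : 𝕃 n × 𝕃 n) → Dec (e ∈ E)
  edge? e = Any.any? (Product.≡-dec _≟ᴸ_ _≟ᴸ_ e) E

  any-in-V? : {P : Pred (𝕃 n) 0ℓ} → P ⇒ (_∈ V) → Decidable P → Dec (∃ P)
  any-in-V? P⇒V P? = map′ (λ p → let f , _ , pf = find p in f , pf) (λ (f , pf) → lose (P⇒V pf) pf)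
    (Any.any? P? V)

  path-start : ∀ {f ps g} → Path G f ps g → f ∈ V
  path-start (stop f∈V)     = f∈V
  path-start (step f∈V _ _) = f∈V

  path-end : ∀ {f ps g} → Path G f ps g → g ∈ V
  path-end (stop f∈V)   = f∈V
  path-end (step _ _ p) = path-end p

  reach-edge : ∀ {f g} → (f , g) ∈ E → Reach G f g
  reach-edge e = let f∈V , g∈V = E⊆V² e in _ , step f∈V e (stop g∈V)

  reach-trans : ∀ {f g h} → Reach G f g → Reach G g h → Reach G f h
  reach-trans (_ , stop _)       q = q
  reach-trans (_ , step f∈V e p) q = let _ , r = reach-trans (_ , p) q in _ , step f∈V e r

  path-∈ : ∀ {f ps g h} → Path G f ps g → h ∈ ps → Reach G f h × Reach G h g
  path-∈ (stop f∈V)         (here refl) = (_ , stop f∈V) , (_ , stop f∈V)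
  path-∈ p@(step f∈V _ _)   (here refl) = (_ , stop f∈V) , (_ , p)
  path-∈ (step f∈V e p)     (there h∈)  = let r , s = path-∈ p h∈ in reach-trans (reach-edge e) r , s

  path-⊆V : ∀ {f ps g h} → Path G f ps g → h ∈ ps → h ∈ V
  path-⊆V p h∈ = path-end (proj₂ (proj₁ (path-∈ p h∈)))

  path? : ∀ f ps g → Dec (Path G f ps g)
  path? f []           g = no λ ()
  path? f (h ∷ [])     g =
    map′ (λ { (refl , refl , f∈V) → stop f∈V })
         (λ { (stop f∈V) → refl , refl , f∈V ; (step _ _ ()) })
         (h ≟ᴸ f ×-dec f ≟ᴸ g ×-dec f ∈? V)
  path? f (h ∷ i ∷ ps) g =
    map′ (λ { (refl , f∈V , e , p) → step f∈V e p })
         (λ { (step f∈V e p@(stop _)) → refl , f∈V , e , p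
            ; (step f∈V e p@(step _ _ _)) → refl , f∈V , e , p })
         (h ≟ᴸ f ×-dec f ∈? V ×-dec edge? (f , i) ×-dec path? i (i ∷ ps) g)

  pathFrom? : ∀ f → Decidable (PathFrom G f)
  pathFrom? f ps = any-in-V? path-end (path? f ps)

  pathTo? : ∀ g → Decidable (PathTo G g)
  pathTo? g ps = any-in-V? path-start (λ f → path? f ps g)

  -- Warshall's algorithm: W contains the inner vertices of the path.
  private
    Via : List (𝕃 n) → 𝕃 n → 𝕃 n → Set
    Via []      f g = (f , g) ∈ E
    Via (w ∷ W) f g = Via W f g ⊎ (Via W f w × Via W w g)

    via? : ∀ W f g → Dec (Via W f g)
    via? []      f g = edge? (f , g)
    via? (w ∷ W) f g = via? W f g ⊎-dec (via? W f w ×-dec via? W w g)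

    via⇒reach : ∀ W {f g} → Via W f g → Reach G f g
    via⇒reach []      e              = reach-edge e
    via⇒reach (w ∷ W) (inj₁ v)       = via⇒reach W v
    via⇒reach (w ∷ W) (inj₂ (u , v)) = reach-trans (via⇒reach W u) (via⇒reach W v)

    edge⇒via : ∀ W {f g} → (f , g) ∈ E → Via W f g
    edge⇒via []      e = e
    edge⇒via (w ∷ W) e = inj₁ (edge⇒via W e)

    -- If both halves pass through `w`, the closed walk between the two visits is cut out.
    via-trans : ∀ {W f g h} → g ∈ W → Via W f g → Via W g h → Via W f h
    via-trans {w ∷ W} (here refl) u v = inj₂ ([ id , proj₁ ]′ u , [ id , proj₂ ]′ v)
    via-trans {w ∷ W} (there g∈W) (inj₁ u)       (inj₁ v)       = inj₁ (via-trans g∈W u v)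
    via-trans {w ∷ W} (there g∈W) (inj₁ u)       (inj₂ (v , z)) = inj₂ (via-trans g∈W u v , z)
    via-trans {w ∷ W} (there g∈W) (inj₂ (u , v)) (inj₁ z)       = inj₂ (u , via-trans g∈W v z)
    via-trans {w ∷ W} (there g∈W) (inj₂ (u , _)) (inj₂ (_ , z)) = inj₂ (u , z)

    path⇒via : ∀ {f ps g} → Path G f ps g → (f ≡ g × f ∈ V) ⊎ Via V f g
    path⇒via (stop f∈V)     = inj₁ (refl , f∈V)
    path⇒via (step f∈V e p) with path⇒via p
    ... | inj₁ (refl , _) = inj₂ (edge⇒via V e)
    ... | inj₂ v          = inj₂ (via-trans (proj₂ (E⊆V² e)) (edge⇒via V e) v)

  reach? : ∀ f g → Dec (Reach G f g)
  reach? f g = map′ [ (λ { (refl , f∈V) → _ , stop f∈V }) , via⇒reach V ]′ (path⇒via ∘ proj₂)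
    ((f ≟ᴸ g ×-dec f ∈? V) ⊎-dec via? V f g)

  reach-sound : ∀ {a} → EdgeSound E a → ∀ {f g} → Reach G f g → ⟦ f ⟧ a ≡ false → ⟦ g ⟧ a ≡ false
  reach-sound s (_ , stop _)     fa = fa
  reach-sound s (_ , step _ e p) fa = reach-sound s (_ , p) (s e fa)

  mutual-≡ : ∀ {a} → EdgeSound E a → ∀ {f g} → Reach G f g → Reach G g f → ⟦ f ⟧ a ≡ ⟦ g ⟧ a
  mutual-≡ s f→g g→f = ≡-from-false (reach-sound s f→g) (reach-sound s g→f)

  -- If `f` vanished at `a`, so would some polynomial together with its negation.
  trivialFailed-sound : ∀ {a f} → EdgeSound E a → TrivialFailed G f → ⟦ f +ᴸ 1ᴸ ⟧ a ≡ false
  trivialFailed-sound {a} {f} s (_ , failed) = trans (⟦+1⟧ f a) (cong not (Bool.¬-not (impossible failed)))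
    where
    impossible : _ → ⟦ f ⟧ a ≢ false
    impossible (inj₁ f→f+1) fa =
      case trans (sym (reach-sound s f→f+1 fa)) (trans (⟦+1⟧ f a) (cong not fa)) of λ ()
    impossible (inj₂ (g , _ , f→g , f→g+1)) fa =
      case trans (sym (reach-sound s f→g+1 fa)) (trans (⟦+1⟧ g a) (cong not (reach-sound s f→g fa))) of λ ()

  tFLS : ∃ (IsTFLS G)
  tFLS = filter failed? V , λ f →
    mk⇔ (proj₂ ∘ ∈-filter⁻ failed? {xs = V}) (λ tf → ∈-filter⁺ failed? (proj₁ tf) tf)
    where
    failed? : Decidable (TrivialFailed G)
    failed? f = f ∈? V ×-dec (reach? f (f +ᴸ 1ᴸ) ⊎-dec
      any-in-V? proj₁ (λ g → g ∈? V ×-dec reach? f g ×-dec reach? f (g +ᴸ 1ᴸ)))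

  descendants : ∀ f → ∃ (IsD G f)
  descendants f = f ∷ filter (reach? f) V , λ g → mk⇔
    (λ { (here e) → inj₁ e ; (there g∈) → inj₂ (∈-filter⁻ (reach? f) {xs = V} g∈) })
    [ here , (λ (g∈V , r) → there (∈-filter⁺ (reach? f) g∈V r)) ]′

  -- Strongly connected components

  sccs : ∃ (AreSCCs G)
  sccs = let 𝒞 , s , c , d = go V id in
    𝒞 , record { sound = s ; complete = c ; distinct = d }
    where
    component : 𝕃 n → List (𝕃 n)
    component f = deduplicate _≟ᴸ_ (filter (λ g → reach? f g ×-dec reach? g f) V)

    component-⇔ : ∀ f g → g ∈ component f ⇔ (g ∈ V × Reach G f g × Reach G g f)
    component-⇔ f g = mk⇔
      (λ g∈ → ∈-filter⁻ (λ g → reach? f g ×-dec reach? g f) {xs = V} (∈-deduplicate⁻ _≟ᴸ_ _ g∈))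
      (λ (g∈V , r) → ∈-deduplicate⁺ _≟ᴸ_ (∈-filter⁺ (λ g → reach? f g ×-dec reach? g f) g∈V r))

    go : ∀ W → (∀ {f} → f ∈ W → f ∈ V) → ∃ λ 𝒞 →
         (∀ {S} → S ∈ 𝒞 → IsSCC G S × Unique S) ×
         (∀ {f} → f ∈ W → ∃ λ S → S ∈ 𝒞 × f ∈ S) ×
         AllPairs (λ S T → ¬ (S ∼[ set ] T)) 𝒞
    go []      W⊆V = [] , (λ ()) , (λ ()) , []
    go (f ∷ W) W⊆V with go W (W⊆V ∘ there)
    ... | 𝒞 , s , c , d with Any.any? (f ∈?_) 𝒞
    ...   | yes p = 𝒞 , s , (λ { (here refl) → find p ; (there g∈) → c g∈ }) , d
    ...   | no ¬p = component f ∷ 𝒞 ,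
              (λ { (here refl) → (f , f∈V , component-⇔ f) , deduplicate-! _≟ᴸ_ _ ; (there S∈) → s S∈ }) ,
              (λ { (here refl) → component f , here refl , f∈
                 ; (there g∈) → let S , S∈ , g∈S = c g∈ in S , there S∈ , g∈S }) ,
              All.tabulate (λ T∈ ~T → ¬p (lose T∈ (Equivalence.to ~T f∈))) ∷ d
      where
      f∈V = W⊆V (here refl)
      f∈  = Equivalence.from (component-⇔ f f) (f∈V , (_ , stop f∈V) , (_ , stop f∈V))

  scc-mutual : ∀ {S} → IsSCC G S → ∀ {f g} → f ∈ S → g ∈ S → Reach G f g
  scc-mutual (h , _ , S⇔) f∈S g∈S =
    let _ , _ , f→h = Equivalence.to (S⇔ _) f∈S
        _ , h→g , _ = Equivalence.to (S⇔ _) g∈S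
    in reach-trans f→h h→g

  scc-⊆V : ∀ {S} → IsSCC G S → ∀ {f} → f ∈ S → f ∈ V
  scc-⊆V (h , _ , S⇔) f∈S = proj₁ (Equivalence.to (S⇔ _) f∈S)

  scc-closed : ∀ {S} → IsSCC G S → ∀ {f g} → f ∈ S → Reach G f g → Reach G g f → g ∈ S
  scc-closed (h , _ , S⇔) f∈S f→g g→f =
    let _ , h→f , f→h = Equivalence.to (S⇔ _) f∈S
    in Equivalence.from (S⇔ _) (path-end (proj₂ f→g) , reach-trans h→f f→g , reach-trans g→f f→h)

  reach-skew : Skew E → (∀ {f} → f ∈ V → f +ᴸ 1ᴸ ∈ V) →
               ∀ {f g} → Reach G f g → Reach G (g +ᴸ 1ᴸ) (f +ᴸ 1ᴸ)
  reach-skew skew +1∈V (_ , stop f∈V)   = _ , stop (+1∈V f∈V)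
  reach-skew skew +1∈V (_ , step _ e p) = reach-trans (reach-skew skew +1∈V (_ , p)) (reach-edge (skew e))

  -- A solution is constant on each component S, and takes the other value
  -- on the component S + 1.
  sccs-even : ∀ {𝒞 a} → AreSCCs G 𝒞 → Skew E → (∀ {f} → f ∈ V → f +ᴸ 1ᴸ ∈ V) → EdgeSound E a →
              2 ∣ length 𝒞
  sccs-even {𝒞} {a} sccs skew +1∈V es = partners⇒even value R# partner
    where
    open AreSCCs sccs

    R : List (𝕃 n) → List (𝕃 n) → Set
    R S T = ∀ f → f ∈ S ⇔ f +ᴸ 1ᴸ ∈ T

    value : List (𝕃 n) → Bool
    value []      = false
    value (f ∷ _) = ⟦ f ⟧ a

    value-∈ : ∀ {S f} → S ∈ 𝒞 → f ∈ S → value S ≡ ⟦ f ⟧ a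
    value-∈ {_ ∷ _} S∈ f∈S = let scc , _ = sound S∈ in
      mutual-≡ es (scc-mutual scc (here refl) f∈S) (scc-mutual scc f∈S (here refl))

    R# : AllPairs (λ S S′ → ∀ T → R S T → ¬ R S′ T) 𝒞
    R# = AllPairs.map (λ S≁S′ T r r′ → S≁S′ λ {f} → mk⇔
      (λ f∈ → Equivalence.from (r′ f) (Equivalence.to (r f) f∈))
      (λ f∈ → Equivalence.from (r f) (Equivalence.to (r′ f) f∈))) distinct

    partner : ∀ {S} → S ∈ 𝒞 → ∃ λ T → T ∈ 𝒞 × R S T × value T ≡ not (value S)
    partner {S} S∈ =
      let scc , _ = sound S∈
          f , f∈V , S⇔ = scc
          f∈S = Equivalence.from (S⇔ f) (f∈V , (_ , stop f∈V) , (_ , stop f∈V))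
          T , T∈ , f+1∈T = complete (+1∈V f∈V)
          scc′ , _ = sound T∈
          skew′ : ∀ {f g} → Reach G (f +ᴸ 1ᴸ) (g +ᴸ 1ᴸ) → Reach G g f
          skew′ r = subst₂ (Reach G) (+ᴸ-cancelʳ _ 1ᴸ) (+ᴸ-cancelʳ _ 1ᴸ) (reach-skew skew +1∈V r)
      in T , T∈ ,
         (λ g → mk⇔
           (λ g∈S → scc-closed scc′ f+1∈T (reach-skew skew +1∈V (scc-mutual scc g∈S f∈S))
                                          (reach-skew skew +1∈V (scc-mutual scc f∈S g∈S)))
           (λ g+1∈T → scc-closed scc f∈S (skew′ (scc-mutual scc′ g+1∈T f+1∈T))
                                         (skew′ (scc-mutual scc′ f+1∈T g+1∈T)))) ,
         trans (value-∈ T∈ f+1∈T) (trans (⟦+1⟧ f a) (cong not (sym (value-∈ S∈ f∈S))))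

  -- `f ≢ g` stems from the absence of repetitions in a component. It makes every merger nonzero,
  -- which is the progress of crGGCP.
  ∈-mergers : ∀ {𝒞 m} → AreSCCs G 𝒞 → m ∈ concatMap mergers 𝒞 →
              ∃₂ λ f g → f ∈ V × g ∈ V × f ≢ g × Reach G f g × Reach G g f × m ≡ f +ᴸ g
  ∈-mergers {𝒞} sccs m∈ with find (∈-concatMap⁻ mergers {xs = 𝒞} m∈)
  ... | f ∷ S , S∈ , m∈S with AreSCCs.sound sccs S∈ | ∈-map⁻ (f +ᴸ_) m∈S
  ...   | scc , f# ∷ _ | g , g∈S , e =
    f , g , scc-⊆V scc (here refl) , scc-⊆V scc (there g∈S) , All.lookup f# g∈S ,
    scc-mutual scc (here refl) (there g∈S) , scc-mutual scc (there g∈S) (here refl) , e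

  Acyclic : Set
  Acyclic = ∀ {f g} → (f , g) ∈ E → ¬ Reach G g f

  -- Without mergers every component is a single vertex, so an edge on a cycle would be a loop.
  no-mergers⇒acyclic : ∀ {𝒞} → AreSCCs G 𝒞 → (∀ {f} → (f , f) ∉ E) → concatMap mergers 𝒞 ≡ [] → Acyclic
  no-mergers⇒acyclic {𝒞} sccs irr none {f} {g} e g→f =
    let S , S∈ , f∈S = AreSCCs.complete sccs (proj₁ (E⊆V² e))
        scc , _ = AreSCCs.sound sccs S∈
    in irr (subst (λ h → (f , h) ∈ E) (singleton S∈ (scc-closed scc f∈S (reach-edge e) g→f) f∈S) e)
    where
    singleton : ∀ {S g h} → S ∈ 𝒞 → g ∈ S → h ∈ S → g ≡ h
    singleton {_ ∷ []}    S∈ (here refl) (here refl) = refl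
    singleton {_ ∷ _ ∷ _} S∈ _           _           =
      case subst (_ ∈_) none (∈-concatMap⁺ mergers (lose S∈ (here refl))) of λ ()
  -- Decisions

  module Decisions (acyclic : Acyclic) where

    path-Unique : ∀ {f ps g} → Path G f ps g → Unique ps
    path-Unique (stop _)       = [] ∷ []
    path-Unique (step f∈V e p) =
      All.tabulate (λ { h∈ refl → acyclic e (proj₁ (path-∈ p h∈)) }) ∷ path-Unique p

    private
      paths : List (List (𝕃 n))
      paths = listsUpTo V (length V)

      -- Paths in an acyclic graph do not repeat vertices, hence are no longer than `V`; so there
      -- are finitely many of them to count.
      ∈-paths : ∀ {f ps g} → Path G f ps g → ps ∈ paths
      ∈-paths p = ∈-listsUpTo (length V) (path-⊆V p) (Unique⇒length-≤ (path-Unique p) (path-⊆V p))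

      from : ∀ f → ∃ (HasSize (PathFrom G f))
      from f = hasSize (List.≡-dec _≟ᴸ_) (pathFrom? f) paths (∈-paths ∘ proj₂)

      to : ∀ f → ∃ (HasSize (PathTo G f))
      to f = hasSize (List.≡-dec _≟ᴸ_) (pathTo? f) paths (∈-paths ∘ proj₂)

    longestPath : ∀ {f} → f ∈ V → ∃ λ f → ∃₂ λ ps g → Path G f ps g ×
                  (∀ f′ qs g′ → Path G f′ qs g′ → length qs ≤ length ps)
    longestPath f∈V
      with maximum ℕ.≤-totalOrder length
             (λ ps → any-in-V? (path-start ∘ proj₂) (λ f → pathFrom? f ps)) paths
    ... | inj₁ none = contradiction (_ , _ , stop f∈V) (none (∈-paths (stop f∈V)))
    ... | inj₂ (ps , (f , g , p) , max) = f , ps , g , p , λ f′ qs g′ q → max (∈-paths q) (f′ , g′ , q)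

    -- The start of a longest path is a source, since an incoming edge would prolong the path.
    source : ∀ {f} → f ∈ V → ∃ (IsSource G)
    source f∈V = let f , ps , g , p , max = longestPath f∈V in
      f , path-start p , λ h e → ℕ.1+n≰n (max h (h ∷ ps) g (step (proj₁ (E⊆V² e)) e p))

    decision : ∀ {f} → f ∈ V → ∀ h → ∃ (IsDecision G h)
    decision f∈V maxReach with maximum ℕ.≤-totalOrder (proj₁ ∘ from) source? V
      where
      source? : Decidable (IsSource G)
      source? f = map′
        (λ (f∈V , none) → f∈V , λ g e → none (g , e))
        (λ (f∈V , none) → f∈V , λ (g , e) → none g e)
        (f ∈? V ×-dec ¬? (any-in-V? (proj₁ ∘ E⊆V²) (λ g → edge? (g , f))))
    ... | inj₁ none = let f , s = source f∈V in contradiction s (none (proj₁ s))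
    ... | inj₂ (f , s , max) = _ , byReach s (proj₂ (from f))
            -- A decision is compared with every size `l` that a set of paths may be given,
            -- `maximum` only with the computed one.
            (λ g l sg size → subst (_≤ _) (HasSize-unique (proj₂ (from g)) size) (max (proj₁ sg) sg))
            (proj₂ (descendants f))
    decision f∈V maxBottleneck
      with maximum ℕ.≤-totalOrder (λ f → proj₁ (to f) + proj₁ (from f)) (_∈? V) V
    ... | inj₁ none = contradiction f∈V (none f∈V)
    ... | inj₂ (f , f∈V , max) = _ , byBottleneck f∈V (proj₂ (to f)) (proj₂ (from f))
            (λ g l₁ l₂ g∈V s₁ s₂ → subst₂ (λ k₁ k₂ → k₁ + k₂ ≤ proj₁ (to f) + proj₁ (from f))
              (HasSize-unique (proj₂ (to g)) s₁) (HasSize-unique (proj₂ (from g)) s₂)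
              (max g∈V g∈V))
            (proj₂ (descendants f)) (proj₂ (descendants (f +ᴸ 1ᴸ)))
    decision f∈V maxPath = let f , ps , g , p , max = longestPath f∈V in _ , byPath p max

  descendants-zero : ∀ {a f D} → EdgeSound E a → IsD G f D → ⟦ f ⟧ a ≡ false → Zero D a
  descendants-zero es isD fa = All.tabulate λ g∈D → case Equivalence.to (isD _) g∈D of λ
    { (inj₁ refl) → fa ; (inj₂ (_ , f→g)) → reach-sound es f→g fa }

  -- For MaxPath: along a path the value can change only from 1 to 0. Either it does so, and `L₁`
  -- holds with f₁ = 1 and fᵣ = 0, or it is constant, and all sums in `L₀` vanish.
  decision-sound : ∀ {h L₀ L₁ a} → IsDecision G h (L₀ , L₁) → EdgeSound E a → Zero L₀ a ⊎ Zero L₁ a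
  decision-sound {a = a} (byReach {f} _ _ _ isD) es with ⟦ f ⟧ a in fa
  ... | false = inj₁ (descendants-zero es isD fa)
  ... | true  = inj₂ (trans (⟦+1⟧ f a) (cong not fa) ∷ [])
  decision-sound {a = a} (byBottleneck {f} _ _ _ _ isD isD′) es with ⟦ f ⟧ a in fa
  ... | false = inj₁ (descendants-zero es isD fa)
  ... | true  = inj₂ (descendants-zero es isD′ (trans (⟦+1⟧ f a) (cong not fa)))
  decision-sound {a = a} (byPath {f} {ps} {g} p _) es with ⟦ f ⟧ a in fa | ⟦ g ⟧ a in ga
  ... | true  | false = inj₂ (trans (⟦+1⟧ f a) (cong not fa) ∷ ga ∷ [])
  ... | false | _     = inj₁ (All.map⁺ (All.tabulate λ {h} h∈ →
          ≡⇒⟦+⟧≡0 f h a (trans fa (sym (reach-sound es (proj₁ (path-∈ p h∈)) fa)))))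
  ... | true  | true  = inj₁ (All.map⁺ (All.tabulate λ {h} h∈ →
          ≡⇒⟦+⟧≡0 f h a (trans fa (sym (Bool.¬-not λ ha →
            case trans (sym ga) (reach-sound es (proj₂ (path-∈ p h∈)) ha) of λ ())))))

  -- For MaxPath, f₁ + f₂ ∈ L₀ makes progress, because a longest path has at
  -- least two vertices as soon as there is an edge.
  decision-progress : (P : Pred (𝕃 n) 0ℓ) → (∀ {f} → f ∈ V → P f × P (f +ᴸ 1ᴸ)) →
                      (∀ {f g} → f ∈ V → g ∈ V → f ≢ g → P (f +ᴸ g)) → (∀ {f} → (f , f) ∉ E) →
                      ∀ {e} → e ∈ E → ∀ {h L₀ L₁} → IsDecision G h (L₀ , L₁) →
                      (∃ λ f → f ∈ L₀ × P f) × (∃ λ f → f ∈ L₁ × P f)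
  decision-progress P PV P+ irr e∈E (byReach (f∈V , _) _ _ isD) =
    (_ , Equivalence.from (isD _) (inj₁ refl) , proj₁ (PV f∈V)) , (_ , here refl , proj₂ (PV f∈V))
  decision-progress P PV P+ irr e∈E (byBottleneck f∈V _ _ _ isD isD′) =
    (_ , Equivalence.from (isD _) (inj₁ refl) , proj₁ (PV f∈V)) ,
    (_ , Equivalence.from (isD′ _) (inj₁ refl) , proj₂ (PV f∈V))
  decision-progress P PV P+ irr e∈E (byPath (stop _) max) =
    let f∈V , g∈V = E⊆V² e∈E in
    contradiction (max _ _ _ (step f∈V e∈E (stop g∈V))) (ℕ.1+n≰n)
  decision-progress P PV P+ irr e∈E (byPath {f} (step {g = g} f∈V e p) max) =
    (f +ᴸ g , ∈-map⁺ (f +ᴸ_) (there (start-∈ p)) ,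
      P+ f∈V (path-start p) λ { refl → irr e }) ,
    (_ , here refl , proj₂ (PV f∈V))
    where
    start-∈ : ∀ {f ps g} → Path G f ps g → f ∈ ps
    start-∈ (stop _)     = here refl
    start-∈ (step _ _ _) = here refl
-- Partial correctness and termination

-- Total correctness over all runs. The two halves cannot be separated at a call: the continuation
-- has to halt only on results that the call can yield, and these are known through its
-- postcondition.
record WP (σ : TermOrdering n) (m : Prog n A) (Q : Pred A 0ℓ) : Set₁ where
  field
    halts  : Halts σ m
    result : ∀ r → σ ⊢ m ⇓ r → Q r

module _ {σ : TermOrdering n} {Q : Pred A 0ℓ} where

  wp-return : ∀ {a} → Q a → WP σ (return a) Q
  wp-return q = record { halts = returns ; result = λ { _ returns → q } }

  wp-choose : ∀ {X : Set} {P : Pred X 0ℓ} {k : X → Prog n A} →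
              Satisfiable P → (∀ x → P x → WP σ (k x) Q) → WP σ (choose-k P k) Q
  wp-choose sat wp = record
    { halts  = chooses sat λ x px → WP.halts (wp x px)
    ; result = λ { r (chooses px d) → WP.result (wp _ px) r d } }

  wp-call : ∀ {π G} {k : Output π n → Prog n A} {R : Pred (Output π n) 0ℓ} →
            WP σ (body σ π G) R → (∀ r → R r → WP σ (k r) Q) → WP σ (call-k π G k) Q
  wp-call wp wp′ = record
    { halts  = calls (WP.halts wp) λ r d → WP.halts (wp′ r (WP.result wp r d))
    ; result = λ { r (calls d d′) → WP.result (wp′ _ (WP.result wp _ d)) r d′ } }

  wp-bind : ∀ {C : Set} {m : Prog n C} {k : C → Prog n A} {R : Pred C 0ℓ} →
            WP σ m R → (∀ c → R c → WP σ (k c) Q) → WP σ (m >>= k) Q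
  wp-bind wp wp′ = go (WP.halts wp) λ r d → wp′ r (WP.result wp r d)
    where
    go : ∀ {C : Set} {m : Prog n C} {k : C → Prog n A} →
         Halts σ m → (∀ c → σ ⊢ m ⇓ c → WP σ (k c) Q) → WP σ (m >>= k) Q
    go returns         f = f _ returns
    go (chooses sat h) f = wp-choose sat λ x px → go (h x px) λ c d → f c (chooses px d)
    go (calls h h′)    f = record
      { halts  = calls h λ r d → WP.halts (go (h′ r d) λ c e → f c (calls d e))
      ; result = λ { r (calls d d′) → WP.result (go (h′ _ d) λ c e → f c (calls d e)) r d′ } }

-- The continuations in the bodies of the procedures are pattern-matching
-- lambdas, which a type cannot mention literally; cont gives access to them.
Cont : Prog n A → Set₁
Cont {A = A} (return _)             = Lift _ A
Cont {n} {A} (choose-k {X = X} _ _) = X → Prog n A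
Cont {n} {A} (call-k π _ _)         = Output π n → Prog n A

cont : (m : Prog n A) → Cont m
cont (return a)     = lift a
cont (choose-k _ k) = k
cont (call-k _ _ k) = k

-- Solutions

Sol : Graph n → Pred (Assignment n) 0ℓ
Sol G a = Zero (Graph.L G) a × EdgeSound (Graph.E G) a

-- `f` does not follow from `L`: adjoining it loses the zero `a`, so that the count of zeros drops
-- strictly.
Separates : List (𝕃 n) → Pred (𝕃 n) 0ℓ
Separates L f = ∃ λ a → Zero L a × ⟦ f ⟧ a ≡ true

zero? : (L : List (𝕃 n)) → Decidable (Zero L)
zero? L a = All.all? (λ f → ⟦ f ⟧ a Bool.≟ false) L

zeros : List (𝕃 n) → ℕ
zeros {n} L = count (zero? L) (vecs n)

zeros-mono : {L M : List (𝕃 n)} → Zero M ⇒ Zero L → zeros M ≤ zeros L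
zeros-mono {n} {L} {M} M⇒L = count-mono-≤ (zero? M) (zero? L) M⇒L (vecs n)

zeros-shrink : {L M : List (𝕃 n)} {f : 𝕃 n} → Zero M ⇒ Zero L → f ∈ M →
               Separates L f → zeros M < zeros L
zeros-shrink {L = L} {M} M⇒L f∈M (a , z , fa) = count-mono-< (zero? M) (zero? L) M⇒L (∈-vecs a) z
  λ z′ → contradiction (trans (sym fa) (All.lookup z′ f∈M)) λ ()

zero-1 : {L : List (𝕃 n)} {a : Assignment n} → 1ᴸ ∈ L → ¬ Zero L a
zero-1 {a = a} 1∈L z = contradiction (trans (sym (⟦1⟧ a)) (All.lookup z 1∈L)) λ ()

-- The outcome of GGCP on which the other procedures rely. `nonconstant` gives the progress of
-- failed linerals and of decisions, `distinct` that of mergers and of MaxPath; `+1∈V` and `skew`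
-- pair up the components.
record Propagated (G : Graph n) : Set where
  open Graph G
  field
    E⊆V²        : ∀ {f g} → (f , g) ∈ E → f ∈ V × g ∈ V
    +1∈V        : ∀ {f} → f ∈ V → f +ᴸ 1ᴸ ∈ V
    skew        : Skew E
    irreflexive : ∀ {f} → (f , f) ∉ E
    nonconstant : ∀ {f} → f ∈ V → Separates L f × Separates L (f +ᴸ 1ᴸ)
    distinct    : ∀ {f g} → f ∈ V → g ∈ V → f ≢ g → Separates L (f +ᴸ g)

-- The body of the loop of GGCP

New : 𝕃 n → 𝕃 n → Pred (𝕃 n) 0ℓ
New f g h = (f ≡ 0ᴸ × g ≢ 0ᴸ × h ≡ g) ⊎ (g ≡ 1ᴸ × f ≢ 1ᴸ × h ≡ f +ᴸ 1ᴸ)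

IsEdge : 𝕃 n → 𝕃 n → Set
IsEdge f g = f ≢ 0ᴸ × f ≢ 1ᴸ × g ≢ 0ᴸ × g ≢ 1ᴸ × f ≢ g

-- The same expression as in `addEdge`, so that `if-elim` applies to the latter by computation.
isEdge? : (f g : 𝕃 n) → Dec (IsEdge f g)
isEdge? f g = ¬? (f ≟ᴸ 0ᴸ) ×-dec ¬? (f ≟ᴸ 1ᴸ) ×-dec
              ¬? (g ≟ᴸ 0ᴸ) ×-dec ¬? (g ≟ᴸ 1ᴸ) ×-dec ¬? (f ≟ᴸ g)

if-elim : {C X : Set} (P : X → Set) (c? : Dec C) {x y : X} → (C → P x) → (¬ C → P y) →
          P (if ⌊ c? ⌋ then x else y)
if-elim P (yes c) px py = px c
if-elim P (no ¬c) px py = py ¬c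

module _ (f g : 𝕃 n) (G : Graph n) where

  open Graph

  addEdge-L : ∀ {h} → h ∈ L (addEdge f g G) ⇔ (h ∈ L G ⊎ New f g h)
  addEdge-L {h} = if-elim (λ M → h ∈ M ⇔ (h ∈ L G ⊎ New f g h)) 2nd? {(f +ᴸ 1ᴸ) ∷ L₁} {L₁}
    (λ (g≡1 , f≢1) → mk⇔
      (λ { (here refl) → inj₂ (inj₂ (g≡1 , f≢1 , refl))
         ; (there h∈) → Sum.map₂ inj₁ (Equivalence.to 1st h∈) })
      (λ { (inj₁ h∈) → there (Equivalence.from 1st (inj₁ h∈))
         ; (inj₂ (inj₁ new)) → there (Equivalence.from 1st (inj₂ new))
         ; (inj₂ (inj₂ (_ , _ , refl))) → here refl }))
    (λ ¬2nd → mk⇔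
      (λ h∈ → Sum.map₂ inj₁ (Equivalence.to 1st h∈))
      (λ { (inj₁ h∈) → Equivalence.from 1st (inj₁ h∈)
         ; (inj₂ (inj₁ new)) → Equivalence.from 1st (inj₂ new)
         ; (inj₂ (inj₂ (g≡1 , f≢1 , _))) → contradiction (g≡1 , f≢1) ¬2nd }))
    where
    1st? = (f ≟ᴸ 0ᴸ) ×-dec ¬? (g ≟ᴸ 0ᴸ)
    2nd? = (g ≟ᴸ 1ᴸ) ×-dec ¬? (f ≟ᴸ 1ᴸ)
    L₁ = if ⌊ 1st? ⌋ then g ∷ L G else L G
    1st : h ∈ L₁ ⇔ (h ∈ L G ⊎ (f ≡ 0ᴸ × g ≢ 0ᴸ × h ≡ g))
    1st = if-elim (λ M → h ∈ M ⇔ (h ∈ L G ⊎ (f ≡ 0ᴸ × g ≢ 0ᴸ × h ≡ g))) 1st? {g ∷ L G} {L G}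
      (λ (f≡0 , g≢0) → mk⇔
        (λ { (here refl) → inj₂ (f≡0 , g≢0 , refl) ; (there h∈) → inj₁ h∈ })
        (λ { (inj₁ h∈) → there h∈ ; (inj₂ (_ , _ , refl)) → here refl }))
      (λ ¬1st → mk⇔ inj₁
        (λ { (inj₁ h∈) → h∈ ; (inj₂ (f≡0 , g≢0 , _)) → contradiction (f≡0 , g≢0) ¬1st }))

  addEdge-V : ∀ {h} → h ∈ V (addEdge f g G) ⇔ (h ∈ V G ⊎ (IsEdge f g × (h ≡ f ⊎ h ≡ g)))
  addEdge-V {h} = if-elim (λ M → h ∈ M ⇔ (h ∈ V G ⊎ (IsEdge f g × (h ≡ f ⊎ h ≡ g))))
    (isEdge? f g) {f ∷ g ∷ V G} {V G}
    (λ e → mk⇔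
      (λ { (here h≡f) → inj₂ (e , inj₁ h≡f)
         ; (there (here h≡g)) → inj₂ (e , inj₂ h≡g)
         ; (there (there h∈)) → inj₁ h∈ })
      (λ { (inj₁ h∈) → there (there h∈)
         ; (inj₂ (_ , inj₁ h≡f)) → here h≡f
         ; (inj₂ (_ , inj₂ h≡g)) → there (here h≡g) }))
    (λ ¬e → mk⇔ inj₁ [ id , (λ (e , _) → contradiction e ¬e) ]′)

  addEdge-E : ∀ {x} → x ∈ E (addEdge f g G) ⇔ (x ∈ E G ⊎ (IsEdge f g × x ≡ (f , g)))
  addEdge-E {x} = if-elim (λ M → x ∈ M ⇔ (x ∈ E G ⊎ (IsEdge f g × x ≡ (f , g))))
    (isEdge? f g) {(f , g) ∷ E G} {E G}
    (λ e → mk⇔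
      (λ { (here x≡) → inj₂ (e , x≡) ; (there x∈) → inj₁ x∈ })
      (λ { (inj₁ x∈) → there x∈ ; (inj₂ (_ , x≡)) → here x≡ }))
    (λ ¬e → mk⇔ inj₁ [ id , (λ (e , _) → contradiction e ¬e) ]′)

-- The loop with its choices of remainders fixed by a function; uniqueness of remainders makes every
-- run agree with it.
addAll : (𝕃 n → 𝕃 n) → List (𝕃 n × 𝕃 n) → Graph n → Graph n
addAll ν []            G = G
addAll ν ((f , g) ∷ E) G = addAll ν E (addEdge (ν f) (ν g) G)

addAll-∈ : {X : Set} (part : Graph n → List X) (Added : 𝕃 n → 𝕃 n → Pred X 0ℓ) →
           (∀ f g G {x} → x ∈ part (addEdge f g G) ⇔ (x ∈ part G ⊎ Added f g x)) →
           ∀ ν E G {x} → x ∈ part (addAll ν E G) ⇔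
             (x ∈ part G ⊎ ∃₂ λ f g → (f , g) ∈ E × Added (ν f) (ν g) x)
addAll-∈ part Added added ν []            G = mk⇔ inj₁ λ { (inj₁ x∈) → x∈ ; (inj₂ (_ , _ , () , _)) }
addAll-∈ part Added added ν ((f , g) ∷ E) G {x} = mk⇔
  (λ x∈ → case Equivalence.to IH x∈ of λ
    { (inj₂ (f , g , e∈ , add)) → inj₂ (f , g , there e∈ , add)
    ; (inj₁ x∈) → Sum.map₂ (λ add → f , g , here refl , add) (Equivalence.to (added (ν f) (ν g) G) x∈) })
  (λ { (inj₁ x∈) → Equivalence.from IH (inj₁ (Equivalence.from (added (ν f) (ν g) G) (inj₁ x∈)))
     ; (inj₂ (_ , _ , here refl , add)) →
         Equivalence.from IH (inj₁ (Equivalence.from (added (ν f) (ν g) G) (inj₂ add)))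
     ; (inj₂ (f , g , there e∈ , add)) → Equivalence.from IH (inj₂ (f , g , e∈ , add)) })
  where
  IH = addAll-∈ part Added added ν E (addEdge (ν f) (ν g) G) {x}

-- Procedures

module _ (σ : TermOrdering n) where

  -- One round of GGCP

  module Round (L₀ V₀ : List (𝕃 n)) (E₀ : List (𝕃 n × 𝕃 n))
               {L : List (𝕃 n)} (rb : IsReducedBasis σ L₀ L) where

    open IsReducedBasis rb

    zero-L : Zero L ≐ Zero L₀
    zero-L = (λ z → All.tabulate λ f∈ → span-zero (proj₂ spans (span-∈ f∈)) z) ,
             (λ z → All.tabulate λ f∈ → span-zero (proj₁ spans (span-∈ f∈)) z)

    separates : ∀ d → Reduced σ L d → d ≢ 0ᴸ → Separates L d
    separates d = reduced-nonzero σ distinctLT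

    -- The sum of both is reduced and vanishes on all zeros of `L`, so it is 0. Uniqueness of
    -- remainders and their compatibility with adding 1 both follow by comparing values.
    reduced-≡ : ∀ d e → Reduced σ L d → Reduced σ L e → (∀ {a} → Zero L a → ⟦ d ⟧ a ≡ ⟦ e ⟧ a) → d ≡ e
    reduced-≡ d e rd re d≈e with (d +ᴸ e) ≟ᴸ 0ᴸ
    ... | yes d+e≡0 = +ᴸ≡0⇒≡ d+e≡0
    ... | no  d+e≢0 = let a , z , v = separates (d +ᴸ e) (reduced-+ σ {f = d} {e} rd re) d+e≢0 in
                      contradiction (trans (sym v) (≡⇒⟦+⟧≡0 d e a (d≈e z))) λ ()

    nr : 𝕃 n → 𝕃 n
    nr f = proj₁ (NR-exists σ L f)

    NR-value : ∀ {f f′ a} → NR σ (map ι L) (ι f) (ι f′) → Zero L a → ⟦ f ⟧ a ≡ ⟦ f′ ⟧ a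
    NR-value r z = NR-eval σ r λ g∈ → case ∈-map⁻ ι g∈ of λ { (g , g∈L , refl) → All.lookup z g∈L }

    NR-reduced : ∀ {f f′} → NR σ (map ι L) (ι f) (ι f′) → Reduced σ L f′
    NR-reduced r e g∈L = NR-irreducible σ r e (∈-map⁺ ι g∈L)

    nr-value : ∀ f {a} → Zero L a → ⟦ f ⟧ a ≡ ⟦ nr f ⟧ a
    nr-value f = NR-value {f} (proj₂ (NR-exists σ L f))

    nr-reduced : ∀ f → Reduced σ L (nr f)
    nr-reduced f = NR-reduced {f} (proj₂ (NR-exists σ L f))

    NR⇒≡nr : ∀ {f f′} → NR σ (map ι L) (ι f) (ι f′) → f′ ≡ nr f
    NR⇒≡nr {f} {f′} r = reduced-≡ f′ (nr f) (NR-reduced {f} r) (nr-reduced f)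
      λ z → trans (sym (NR-value {f} r z)) (nr-value f z)

    -- The zero of `L` makes 1 reduced. Without one, both remainders are 0 and the equation fails.
    nr-+1 : ∀ {a} f → Zero L a → nr (f +ᴸ 1ᴸ) ≡ nr f +ᴸ 1ᴸ
    nr-+1 f z = reduced-≡ (nr (f +ᴸ 1ᴸ)) (nr f +ᴸ 1ᴸ) (nr-reduced (f +ᴸ 1ᴸ))
      (reduced-+ σ {f = nr f} {1ᴸ} (nr-reduced f) (reduced-1 σ z))
      λ {a} z → trans (sym (nr-value (f +ᴸ 1ᴸ) z)) (trans (⟦+1⟧ f a)
        (trans (cong not (nr-value f z)) (sym (⟦+1⟧ (nr f) a))))

    H : Graph n
    H = addAll nr E₀ (graph L [] [])

    addEdges-wp : ∀ E G → WP σ (addEdges σ L E G) (_≡ addAll nr E G)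
    addEdges-wp []            G = wp-return refl
    addEdges-wp ((f , g) ∷ E) G =
      wp-choose (NR-exists σ L f) λ f′ rf → wp-choose (NR-exists σ L g) λ g′ rg →
      subst (λ K → WP σ (addEdges σ L E (addEdge f′ g′ G)) (_≡ addAll nr E K))
        (cong₂ (λ p q → addEdge p q G) (NR⇒≡nr {f} rf) (NR⇒≡nr {g} rg))
        (addEdges-wp E (addEdge f′ g′ G))

    L-∈ : ∀ {h} → h ∈ Graph.L H ⇔ (h ∈ L ⊎ ∃₂ λ f g → (f , g) ∈ E₀ × New (nr f) (nr g) h)
    L-∈ = addAll-∈ Graph.L New addEdge-L nr E₀ (graph L [] [])

    V-∈ : ∀ {h} → h ∈ Graph.V H ⇔
          (h ∈ [] ⊎ ∃₂ λ f g → (f , g) ∈ E₀ × IsEdge (nr f) (nr g) × (h ≡ nr f ⊎ h ≡ nr g))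
    V-∈ = addAll-∈ Graph.V (λ f g h → IsEdge f g × (h ≡ f ⊎ h ≡ g)) addEdge-V nr E₀ (graph L [] [])

    E-∈ : ∀ {x} → x ∈ Graph.E H ⇔
          (x ∈ [] ⊎ ∃₂ λ f g → (f , g) ∈ E₀ × IsEdge (nr f) (nr g) × x ≡ (nr f , nr g))
    E-∈ = addAll-∈ Graph.E (λ f g x → IsEdge f g × x ≡ (f , g)) addEdge-E nr E₀ (graph L [] [])

    zero-H : Zero (Graph.L H) ⇒ Zero L
    zero-H z = All.tabulate λ h∈ → All.lookup z (Equivalence.from L-∈ (inj₁ h∈))

    sol-H : Sol (graph L₀ V₀ E₀) ≐ Sol H
    sol-H = to , from
      where
      to : Sol (graph L₀ V₀ E₀) ⇒ Sol H
      to {a} (z₀ , es) = All.tabulate (λ h∈ → vanish (Equivalence.to L-∈ h∈)) ,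
                         λ e∈ → edge (Equivalence.to E-∈ e∈)
        where
        z : Zero L a
        z = proj₂ zero-L z₀
        es′ : ∀ {f g} → (f , g) ∈ E₀ → ⟦ nr f ⟧ a ≡ false → ⟦ nr g ⟧ a ≡ false
        es′ {f} {g} e∈ fa = trans (sym (nr-value g z)) (es e∈ (trans (nr-value f z) fa))
        vanish : ∀ {h} → h ∈ L ⊎ (∃₂ λ f g → (f , g) ∈ E₀ × New (nr f) (nr g) h) → ⟦ h ⟧ a ≡ false
        vanish (inj₁ h∈L) = All.lookup z h∈L
        vanish (inj₂ (f , g , e∈ , inj₁ (f≡0 , _ , refl))) =
          es′ e∈ (trans (cong (λ p → ⟦ p ⟧ a) f≡0) (⟦0⟧ a))
        vanish (inj₂ (f , g , e∈ , inj₂ (g≡1 , _ , refl))) =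
          trans (⟦+1⟧ (nr f) a) (cong not (Bool.¬-not λ fa →
          contradiction (trans (sym (⟦1⟧ a)) (trans (cong (λ p → ⟦ p ⟧ a) (sym g≡1)) (es′ e∈ fa))) λ ()))
        edge : ∀ {p q} →
               (p , q) ∈ [] ⊎ (∃₂ λ f g → (f , g) ∈ E₀ × IsEdge (nr f) (nr g) × (p , q) ≡ (nr f , nr g)) →
               ⟦ p ⟧ a ≡ false → ⟦ q ⟧ a ≡ false
        edge (inj₂ (f , g , e∈ , _ , refl)) = es′ e∈

      from : Sol H ⇒ Sol (graph L₀ V₀ E₀)
      from {a} (zH , es) = proj₁ zero-L (zero-H zH) , λ {f} {g} e∈ fa →
        trans (nr-value g (zero-H zH)) (implies e∈ (trans (sym (nr-value f (zero-H zH))) fa))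
        where
        implies : ∀ {f g} → (f , g) ∈ E₀ → ⟦ nr f ⟧ a ≡ false → ⟦ nr g ⟧ a ≡ false
        -- Edges that leave no trace have g′ = 0, f′ = g′ or f′ = 1 and hold trivially; the others
        -- are recorded in `L` or in `E`.
        implies {f} {g} e∈ fa with nr f ≟ᴸ 0ᴸ | nr f ≟ᴸ 1ᴸ | nr g ≟ᴸ 0ᴸ | nr g ≟ᴸ 1ᴸ | nr f ≟ᴸ nr g
        ... | _       | _       | yes g≡0 | _       | _       = trans (cong (λ p → ⟦ p ⟧ a) g≡0) (⟦0⟧ a)
        ... | _       | _       | _       | _       | yes f≡g = trans (cong (λ p → ⟦ p ⟧ a) (sym f≡g)) fa
        ... | _       | yes f≡1 | _       | _       | _       =
          contradiction (trans (sym fa) (trans (cong (λ p → ⟦ p ⟧ a) f≡1) (⟦1⟧ a))) λ ()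
        ... | yes f≡0 | _       | no g≢0  | _       | _       =
          All.lookup zH (Equivalence.from L-∈ (inj₂ (f , g , e∈ , inj₁ (f≡0 , g≢0 , refl))))
        ... | _       | no f≢1  | _       | yes g≡1 | _       =
          contradiction (trans (sym (cong not fa)) (trans (sym (⟦+1⟧ (nr f) a)) (All.lookup zH
            (Equivalence.from L-∈ (inj₂ (f , g , e∈ , inj₂ (g≡1 , f≢1 , refl))))))) λ ()
        ... | no f≢0  | no f≢1  | no g≢0  | no g≢1  | no f≢g  =
          es (Equivalence.from E-∈ (inj₂ (f , g , e∈ , (f≢0 , f≢1 , g≢0 , g≢1 , f≢g) , refl))) fa

    1≢0 : 1ᴸ ≢ 0ᴸ {n}
    1≢0 ()

    new-separates : ∀ {f g h} → New (nr f) (nr g) h → Separates L h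
    new-separates {f} {g} (inj₁ (_ , g≢0 , refl)) = separates (nr g) (nr-reduced g) g≢0
    new-separates {f} {g} (inj₂ (g≡1 , f≢1 , refl)) =
      -- The remainder 1 of `g` is reduced and nonzero, which yields the zero of `L` that
      -- `reduced-1` asks for.
      let a , z , _ = separates (nr g) (nr-reduced g) (λ g≡0 → 1≢0 (trans (sym g≡1) g≡0))
      in separates (nr f +ᴸ 1ᴸ) (reduced-+ σ {f = nr f} {1ᴸ} (nr-reduced f) (reduced-1 σ z)) (f≢1 ∘ +ᴸ≡0⇒≡)

    +1≢ : ∀ {f g : 𝕃 n} → f ≢ g +ᴸ 1ᴸ → f +ᴸ 1ᴸ ≢ g
    +1≢ {f} f≢ e = f≢ (trans (sym (+ᴸ-cancelʳ f 1ᴸ)) (cong (_+ᴸ 1ᴸ) e))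

    skewEdge : ∀ {p q : 𝕃 n} → IsEdge p q → IsEdge (q +ᴸ 1ᴸ) (p +ᴸ 1ᴸ)
    skewEdge {p} {q} (p≢0 , p≢1 , q≢0 , q≢1 , p≢q) =
      +1≢ (q≢1 ∘ (λ e → trans e (+ᴸ-identityˡ 1ᴸ))) , +1≢ (q≢0 ∘ (λ e → trans e (+ᴸ-self 1ᴸ))) ,
      +1≢ (p≢1 ∘ (λ e → trans e (+ᴸ-identityˡ 1ᴸ))) , +1≢ (p≢0 ∘ (λ e → trans e (+ᴸ-self 1ᴸ))) ,
      +1≢ (λ e → p≢q (sym (trans e (+ᴸ-cancelʳ p 1ᴸ))))

    -- The nonzero remainder of `f` provides the zero of `L` that `nr-+1` asks for.
    skew-from : Skew E₀ → ∀ {f g} → (f , g) ∈ E₀ → IsEdge (nr f) (nr g) →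
                (nr g +ᴸ 1ᴸ , nr f +ᴸ 1ᴸ) ∈ Graph.E H
    skew-from skew₀ {f} {g} e∈ edge =
      let _ , z , _ = separates (nr f) (nr-reduced f) (proj₁ edge)
          f+1 = nr-+1 f z
          g+1 = nr-+1 g z
      in Equivalence.from E-∈ (inj₂ (g +ᴸ 1ᴸ , f +ᴸ 1ᴸ , skew₀ e∈ ,
           subst₂ IsEdge (sym g+1) (sym f+1) (skewEdge edge) , sym (cong₂ _,_ g+1 f+1)))

    skew : Skew E₀ → Skew (Graph.E H)
    skew skew₀ e∈ with Equivalence.to E-∈ e∈
    ... | inj₂ (f , g , e∈₀ , edge , refl) = skew-from skew₀ e∈₀ edge

    shrink : ¬ (L ∼[ set ] Graph.L H) → zeros (Graph.L H) < zeros L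
    shrink L≁ with All.all? (_∈? L) (Graph.L H)
    ... | yes H⊆L = ⊥-elim (L≁ (mk⇔ (λ h∈ → Equivalence.from L-∈ (inj₁ h∈)) (All.lookup H⊆L)))
    ... | no  H⊈L with find (All.¬All⇒Any¬ (_∈? L) (Graph.L H) H⊈L)
    ...   | h , h∈H , h∉L with Equivalence.to L-∈ h∈H
    ...     | inj₁ h∈L               = contradiction h∈L h∉L
    ...     | inj₂ (f , g , _ , new) = zeros-shrink {L = L} zero-H h∈H (new-separates {f} {g} new)

    propagated : Skew E₀ → L ∼[ set ] Graph.L H → Propagated H
    propagated skew₀ L∼ = record
      { E⊆V² = edge-V
      ; +1∈V = λ h∈ → +1-closed (Equivalence.to V-∈ h∈)
      ; skew = skew skew₀
      ; irreflexive = irreflexive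
      ; nonconstant = λ h∈ → nonconstant (Equivalence.to V-∈ h∈)
      ; distinct = λ {f} {g} f∈ g∈ f≢g →
          lift-sep (f +ᴸ g) (separates (f +ᴸ g)
            (reduced-+ σ {f = f} {g} (V-reduced f∈) (V-reduced g∈)) (f≢g ∘ +ᴸ≡0⇒≡))
      }
      where
      lift-sep : ∀ d → Separates L d → Separates (Graph.L H) d
      lift-sep d (a , z , v) = a , All.tabulate (λ h∈ → All.lookup z (Equivalence.from L∼ h∈)) , v

      InV : Pred (𝕃 n) 0ℓ
      InV h = h ∈ [] ⊎ ∃₂ λ f g → (f , g) ∈ E₀ × IsEdge (nr f) (nr g) × (h ≡ nr f ⊎ h ≡ nr g)

      V-reduced : ∀ {h} → h ∈ Graph.V H → Reduced σ L h
      V-reduced h∈ with Equivalence.to V-∈ h∈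
      ... | inj₂ (f , g , _ , _ , inj₁ refl) = nr-reduced f
      ... | inj₂ (f , g , _ , _ , inj₂ refl) = nr-reduced g

      nonconst : ∀ f → nr f ≢ 0ᴸ → nr f ≢ 1ᴸ →
                 Separates (Graph.L H) (nr f) × Separates (Graph.L H) (nr f +ᴸ 1ᴸ)
      nonconst f f≢0 f≢1 =
        let s@(a , z , _) = separates (nr f) (nr-reduced f) f≢0 in
        lift-sep (nr f) s ,
        lift-sep (nr f +ᴸ 1ᴸ) (separates (nr f +ᴸ 1ᴸ)
          (reduced-+ σ {f = nr f} {1ᴸ} (nr-reduced f) (reduced-1 σ z)) (f≢1 ∘ +ᴸ≡0⇒≡))

      nonconstant : ∀ {h} → InV h → Separates (Graph.L H) h × Separates (Graph.L H) (h +ᴸ 1ᴸ)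
      nonconstant (inj₂ (f , g , _ , (f≢0 , f≢1 , _) , inj₁ refl))         = nonconst f f≢0 f≢1
      nonconstant (inj₂ (f , g , _ , (_ , _ , g≢0 , g≢1 , _) , inj₂ refl)) = nonconst g g≢0 g≢1

      edge-V : ∀ {p q} → (p , q) ∈ Graph.E H → p ∈ Graph.V H × q ∈ Graph.V H
      edge-V e∈ with Equivalence.to E-∈ e∈
      ... | inj₂ (f , g , e∈₀ , edge , refl) =
        Equivalence.from V-∈ (inj₂ (f , g , e∈₀ , edge , inj₁ refl)) ,
        Equivalence.from V-∈ (inj₂ (f , g , e∈₀ , edge , inj₂ refl))

      irreflexive : ∀ {f} → (f , f) ∉ Graph.E H
      irreflexive e∈ with Equivalence.to E-∈ e∈
      ... | inj₂ (_ , _ , _ , (_ , _ , _ , _ , f≢g) , e) = f≢g (trans (sym (cong proj₁ e)) (cong proj₂ e))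

      +1-closed : ∀ {h} → InV h → h +ᴸ 1ᴸ ∈ Graph.V H
      +1-closed (inj₂ (f , g , e∈ , edge , inj₁ refl)) = proj₂ (edge-V (skew-from skew₀ e∈ edge))
      +1-closed (inj₂ (f , g , e∈ , edge , inj₂ refl)) = proj₁ (edge-V (skew-from skew₀ e∈ edge))

  -- Contracts of the three procedures

  ∼? : (L M : List (𝕃 n)) → Dec (L ∼[ set ] M)
  ∼? L M = map′ (λ (L⊆M , M⊆L) → mk⇔ (All.lookup L⊆M) (All.lookup M⊆L))
    (λ L∼M → All.tabulate (Equivalence.to L∼M) , All.tabulate (Equivalence.from L∼M))
    (All.all? (_∈? M) L ×-dec All.all? (_∈? L) M)

  -- `zeros⊆` bounds the measure of the caller. It does not follow from `solutions`, which also
  -- involves the edges.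
  record GGCP-Post (G H : Graph n) : Set where
    field
      propagated : Propagated H
      solutions  : Sol G ≐ Sol H
      zeros⊆     : Zero (Graph.L H) ⇒ Zero (Graph.L G)

  GGCP-Post-trans : ∀ {G H K} → Sol G ≐ Sol H → Zero (Graph.L H) ⇒ Zero (Graph.L G) →
                    GGCP-Post H K → GGCP-Post G K
  GGCP-Post-trans sol z⊆ post = record
    { propagated = propagated
    ; solutions  = proj₁ solutions ∘ proj₁ sol , proj₂ sol ∘ proj₂ solutions
    ; zeros⊆     = λ z → z⊆ (zeros⊆ z) }
    where open GGCP-Post post

  ggcp-wp : ∀ G → Skew (Graph.E G) → Acc _<_ (zeros (Graph.L G)) → WP σ (ggcp σ G) (GGCP-Post G)
  ggcp-wp (graph L₀ V₀ E₀) skew₀ (acc rec) =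
    wp-choose (reducedBasis σ L₀) round
    where
    G = graph L₀ V₀ E₀
    round : ∀ L → IsReducedBasis σ L₀ L → WP σ (cont (ggcp σ G) L) (GGCP-Post G)
    round L rb = wp-bind (addEdges-wp E₀ (graph L [] [])) λ { _ refl →
      wp-choose (∼? L (Graph.L H) , _) λ
        { (yes L∼) _ → wp-return record
            { propagated = propagated skew₀ L∼
            ; solutions  = sol-H
            ; zeros⊆     = zeros⊆ }
        ; (no L≁)  _ → wp-call
            (ggcp-wp H (skew skew₀)
              (rec (ℕ.<-≤-trans (shrink L≁) (zeros-mono {L = L₀} {L} (proj₁ zero-L)))))
            (λ K post → wp-return (GGCP-Post-trans sol-H zeros⊆ post)) } }
      where
      open Round L₀ V₀ E₀ rb
      zeros⊆ : Zero (Graph.L H) ⇒ Zero L₀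
      zeros⊆ z = proj₁ zero-L (zero-H z)

  record CrGGCP-Post (G H : Graph n) : Set where
    field
      post    : GGCP-Post G H
      acyclic : ∀ {f g} → (f , g) ∈ Graph.E H → ¬ Reach H g f

  adjoin : List (𝕃 n) → Graph n → Graph n
  adjoin M (graph L V E) = graph (L ++ M) V E

  sol-adjoin : ∀ G M {a} → Sol G a → Zero M a → Sol (adjoin M G) a
  sol-adjoin G M (z , es) zM = All.++⁺ z zM , es

  sol-adjoin⁻ : ∀ G M {a} → Sol (adjoin M G) a → Sol G a
  sol-adjoin⁻ G M (z , es) = All.++⁻ˡ (Graph.L G) z , es

  sol-adjoin-≐ : ∀ G M → Sol G ⇒ Zero M → Sol G ≐ Sol (adjoin M G)
  sol-adjoin-≐ G M implied = (λ s → sol-adjoin G M s (implied s)) , sol-adjoin⁻ G M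

  Falsum : Graph n
  Falsum = graph (1ᴸ ∷ tabulate xᴸ) [] []

  -- Without vertices the graph conditions are vacuous, and 1 in `L` leaves no solution, in
  -- agreement with the hypothesis.
  falsum-post : ∀ {G} → Empty (Sol G) → CrGGCP-Post G Falsum
  falsum-post unsat = record
    { post = record
      { propagated = record
        { E⊆V² = λ () ; +1∈V = λ () ; skew = λ ()
        ; irreflexive = λ () ; nonconstant = λ () ; distinct = λ () }
      ; solutions = (λ s → contradiction s (unsat _)) , (λ (z , _) → contradiction z (zero-1 (here refl)))
      ; zeros⊆    = λ z → contradiction z (zero-1 (here refl)) }
    ; acyclic = λ () }

  crggcp-wp : ∀ G → Skew (Graph.E G) → Acc _<_ (zeros (Graph.L G)) → WP σ (crggcp σ G) (CrGGCP-Post G)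
  crggcp-wp G skew₀ (acc rec) =
    -- The call of GGCP runs its own induction; `rec` is reserved for the recursive call of crGGCP.
    wp-call (ggcp-wp G skew₀ (<-wellFounded _)) components
    where
    merge : ∀ H → GGCP-Post G H → ∀ 𝒞 → AreSCCs H 𝒞 → (¬odd : ¬ (2 ∤ length 𝒞)) →
            WP σ (cont (cont (cont (crggcp σ G) H) 𝒞) (no ¬odd)) (CrGGCP-Post G)
    merge H post 𝒞 sccs ¬odd with concatMap mergers 𝒞 in eq
    ... | [] = wp-return record
            { post = post ; acyclic = Paths.no-mergers⇒acyclic H E⊆V² sccs irreflexive eq }
      where
      open GGCP-Post post
      open Propagated propagated
    ... | m ∷ M = wp-call
            (crggcp-wp (adjoin (m ∷ M) H) skew
              (rec (ℕ.<-≤-trans (zeros-shrink {L = Graph.L H} (All.++⁻ˡ (Graph.L H))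
                                  (∈-++⁺ʳ (Graph.L H) (here refl))
                                  (separated (subst (m ∈_) (sym eq) (here refl))))
                                (zeros-mono {L = Graph.L G} {Graph.L H} zeros⊆))))
            λ K post′ → wp-return record
              { post    = GGCP-Post-trans {G} {H} solutions zeros⊆ (GGCP-Post-trans {H}
                            (sol-adjoin-≐ H (m ∷ M) λ s → All.tabulate λ {x} m∈ →
                              merged {m = x} (proj₂ s) (subst (x ∈_) (sym eq) m∈))
                            (All.++⁻ˡ (Graph.L H)) (CrGGCP-Post.post post′))
              ; acyclic = CrGGCP-Post.acyclic post′ }
      where
      open GGCP-Post post
      open Propagated propagated

      separated : ∀ {m} → m ∈ concatMap mergers 𝒞 → Separates (Graph.L H) m
      separated m∈ with Paths.∈-mergers H E⊆V² sccs m∈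
      ... | f , g , f∈V , g∈V , f≢g , _ , _ , refl = distinct f∈V g∈V f≢g

      merged : ∀ {a m} → EdgeSound (Graph.E H) a → m ∈ concatMap mergers 𝒞 → ⟦ m ⟧ a ≡ false
      merged {a} es m∈ with Paths.∈-mergers H E⊆V² sccs m∈
      ... | f , g , _ , _ , _ , f→g , g→f , refl = ≡⇒⟦+⟧≡0 f g a (Paths.mutual-≡ H E⊆V² es f→g g→f)

    components : ∀ H → GGCP-Post G H → WP σ (cont (crggcp σ G) H) (CrGGCP-Post G)
    components H post =
      wp-choose (Paths.sccs H E⊆V²) λ 𝒞 sccs →
      wp-choose (¬? (2 ∣? length 𝒞) , _) λ
        { (yes odd) _ → wp-return (falsum-post λ a s →
            odd (Paths.sccs-even H E⊆V² sccs skew +1∈V (proj₂ (proj₁ solutions s))))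
        ; (no ¬odd) _ → merge H post 𝒞 sccs ¬odd }
      where
      open GGCP-Post post
      open Propagated propagated

  Correct : Pred (Assignment n) 0ℓ → Pred (Result n) 0ℓ
  Correct S UNSAT   = Empty S
  Correct S (SAT a) = S a

  correct-≐ : ∀ {S T} → S ≐ T → ∀ r → Correct T r → Correct S r
  correct-≐ (S⇒T , _) UNSAT   empty a s = empty a (S⇒T s)
  correct-≐ (_ , T⇒S) (SAT a) t         = T⇒S t

  -- A vector of coefficients is a `Subset`, so the search runs over finitely many of them.
  span? : (L : List (𝕃 n)) (f : 𝕃 n) → Dec (Span L f)
  span? L f = Subset.anySubset? λ cs → lincomb L cs ≟ᴸ f

  decide-wp : ∀ H {e} → e ∈ Graph.E H → Propagated H → (∀ {f g} → (f , g) ∈ Graph.E H → ¬ Reach H g f) →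
              (∀ M → (∃ λ f → f ∈ M × Separates (Graph.L H) f) →
                WP σ (solver σ (adjoin M H)) (Correct (Sol (adjoin M H)))) →
              WP σ (decide H) (Correct (Sol H))
  decide-wp H e∈E prop acyclic rec =
    -- One heuristic shows that the choice is not stuck; the continuation treats an arbitrary `h`.
    wp-choose (maxPath , _) λ h _ →
    wp-choose (Paths.Decisions.decision H E⊆V² acyclic (proj₁ (E⊆V² e∈E)) h) λ (L₀ , L₁) isDecision →
    let progress₀ , progress₁ = Paths.decision-progress H E⊆V² (Separates (Graph.L H))
                                  nonconstant distinct irreflexive e∈E isDecision in
    wp-call (rec L₀ progress₀) λ
      { (SAT a) s → wp-return (sol-adjoin⁻ H L₀ s)
      ; UNSAT unsat₀ → wp-call (rec L₁ progress₁) λ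
          { (SAT a) s → wp-return (sol-adjoin⁻ H L₁ s)
          ; UNSAT unsat₁ → wp-return λ a s →
              [ (λ z → unsat₀ a (sol-adjoin H L₀ s z)) , (λ z → unsat₁ a (sol-adjoin H L₁ s z)) ]′
                (Paths.decision-sound H E⊆V² isDecision (proj₂ s)) } }
    where open Propagated prop

  solver-wp : ∀ G → Skew (Graph.E G) → Acc _<_ (zeros (Graph.L G)) → WP σ (solver σ G) (Correct (Sol G))
  solver-wp G skew₀ (acc rec) =
    wp-call (crggcp-wp G skew₀ (<-wellFounded _)) propagate
    where
    recurse : ∀ H → CrGGCP-Post G H → ∀ M → (∃ λ f → f ∈ M × Separates (Graph.L H) f) →
              WP σ (solver σ (adjoin M H)) (Correct (Sol (adjoin M H)))
    recurse H post M (f , f∈M , sep) =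
      solver-wp (adjoin M H) (Propagated.skew propagated)
        (rec (ℕ.<-≤-trans (zeros-shrink {L = Graph.L H} (All.++⁻ˡ (Graph.L H))
                            (∈-++⁺ʳ (Graph.L H) f∈M) sep)
                          (zeros-mono {L = Graph.L G} {Graph.L H} zeros⊆)))
      where open GGCP-Post (CrGGCP-Post.post post)

    finish : ∀ H → CrGGCP-Post G H → (1∉ : ¬ Span (Graph.L H) 1ᴸ) →
             WP σ (cont (cont (cont (solver σ G) H) []) (no 1∉)) (Correct (Sol G))
    finish H@(graph L V []) post 1∉ =
      -- Without edges, every common zero of `L` is a solution.
      wp-choose common-zero λ a z →
        wp-return (proj₂ solutions (All.tabulate (λ f∈ → z _ (∈-map⁺ ι f∈)) , λ ()))
      where
      open GGCP-Post (CrGGCP-Post.post post)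
      common-zero : Satisfiable (𝒵 (_∈ map ι L))
      common-zero with linear-nullstellensatz L
      ... | inj₂ 1∈      = contradiction 1∈ 1∉
      ... | inj₁ (a , z) = a , λ p p∈ → case ∈-map⁻ ι p∈ of λ { (f , f∈ , refl) → All.lookup z f∈ }
    finish H@(graph L V (e ∷ E)) post 1∉ = record
      { halts  = WP.halts wp
      ; result = λ r d → correct-≐ solutions r (WP.result wp r d) }
      where
      open GGCP-Post (CrGGCP-Post.post post)
      wp = decide-wp H (here refl) propagated (CrGGCP-Post.acyclic post) (recurse H post)

    propagate : ∀ H → CrGGCP-Post G H → WP σ (cont (solver σ G) H) (Correct (Sol G))
    propagate H post =
      wp-choose (Paths.tFLS H E⊆V²) λ
        { (f ∷ fs) isTFLS → wp-call
            (recurse H post (map (_+ᴸ 1ᴸ) (f ∷ fs))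
              (_ , here refl , proj₂ (nonconstant (proj₁ (Equivalence.to (isTFLS f) (here refl))))))
            λ r c → wp-return (correct-≐ solutions r (correct-≐
              (sol-adjoin-≐ H (map (_+ᴸ 1ᴸ) (f ∷ fs)) λ s → All.map⁺ (All.tabulate λ {g} g∈ →
                Paths.trivialFailed-sound H E⊆V² {f = g} (proj₂ s)
                  (Equivalence.to (isTFLS g) g∈))) r c))
        ; [] _ → wp-choose (span? (Graph.L H) 1ᴸ , _) λ
            { (yes 1∈) _ → wp-return λ a s →
                contradiction (trans (sym (⟦1⟧ a)) (span-zero 1∈ (proj₁ (proj₁ solutions s)))) λ ()
            ; (no 1∉)  _ → finish H post 1∉ } }
      where
      open GGCP-Post (CrGGCP-Post.post post)
      open Propagated propagated

-- The zeros of I_F are the common zeros of its generators, and the generator fg of an edge (f + 1,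
-- g) vanishes at `a` exactly if f + 1 = 0 implies g = 0 there.
solutions-IGS : {F : Formula n} {G : Graph n} → IsIGS F G → 𝒮 F ≐ Sol G
solutions-IGS {n} {F} {G} igs with IsIGS.represents igs
... | I , ideal , I≐ = to , from
  where
  open Graph G
  module I = IsIdealOf ideal

  Products : Pred (𝔹 n) 0ℓ
  Products p = ∃₂ λ f g → (f +ᴸ 1ᴸ , g) ∈ E × p ≡ ι f *ᴮ ι g

  generated : {S : Pred (𝔹 n) 0ℓ} {a : Assignment n} → 𝒵 S a → 𝒵 ⟨ S ⟩ a
  generated     z p (generator s)     = z p s
  generated {a = a} z _ zero          = eval-0 a
  generated {a = a} z _ (plus {p} {q} r s)  =
    trans (eval-+ p q a) (cong₂ _xor_ (generated z p r) (generated z q s))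
  generated {a = a} z _ (times h {p} r) =
    trans (eval-* h p a) (trans (cong (eval h a ∧_) (generated z p r)) (Bool.∧-zeroʳ _))

  to : 𝒮 F ⇒ Sol G
  to {a} s = All.tabulate (λ {f} f∈ → z (ι f) (proj₂ I≐
               (ι f , 0ᴮ , generator (∈-map⁺ ι f∈) , zero , sym (+ᴮ-identityʳ (ι f))))) , edge
    where
    z = proj₂ I.zeros s
    edge : EdgeSound E a
    edge {f} {g} e∈ fa = trans (sym (cong (_∧ ⟦ g ⟧ a) (trans (⟦+1⟧ f a) (cong not fa))))
      (trans (sym (eval-* (ι (f +ᴸ 1ᴸ)) (ι g) a)) (z _ (proj₂ I≐
        (0ᴮ , ι (f +ᴸ 1ᴸ) *ᴮ ι g , zero ,
         generator (f +ᴸ 1ᴸ , g , subst (λ h → (h , g) ∈ E) (sym (+ᴸ-cancelʳ f 1ᴸ)) e∈ , refl) ,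
         sym (+ᴮ-identityˡ _)))))

  from : Sol G ⇒ 𝒮 F
  from {a} (z , es) = proj₁ I.zeros λ p p∈ → case proj₁ I≐ p∈ of λ
    { (q , r , q∈ , r∈ , refl) → trans (eval-+ q r a)
        (cong₂ _xor_ (generated linear-zero q q∈) (generated product-zero r r∈)) }
    where
    linear-zero : 𝒵 (_∈ map ι L) a
    linear-zero p p∈ = case ∈-map⁻ ι p∈ of λ { (f , f∈ , refl) → All.lookup z f∈ }

    product-zero : 𝒵 Products a
    product-zero _ (f , g , e∈ , refl) = trans (eval-* (ι f) (ι g) a) (vanish (⟦ f ⟧ a) refl)
      where
      vanish : ∀ b → ⟦ f ⟧ a ≡ b → ⟦ f ⟧ a ∧ ⟦ g ⟧ a ≡ false
      vanish false fa = cong (_∧ ⟦ g ⟧ a) fa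
      vanish true  fa = trans (cong (⟦ f ⟧ a ∧_) (es e∈ (trans (⟦+1⟧ f a) (cong not fa)))) (Bool.∧-zeroʳ _)

skew-IGS : {F : Formula n} {G : Graph n} → IsIGS F G → Skew (Graph.E G)
skew-IGS {G = G} igs {f} {g} e∈ =
  IsIGS.skew igs (subst (λ h → (h , g) ∈ Graph.E G) (sym (+ᴸ-cancelʳ f 1ᴸ)) e∈)

proposition4p24 : (n : ℕ) (σ : TermOrdering n) (F : Formula n) (G : Graph n) → IsIGS F G →
    Halts σ (call SOLVER G) ×
    (∀ r → σ ⊢ call SOLVER G ⇓ r →
    (r ≡ UNSAT ⇔ Empty (𝒮 F)) ×
    (¬ Empty (𝒮 F) → ∃ λ a → r ≡ SAT a × 𝒮 F a))
proposition4p24 n σ F G igs = WP.halts wp , λ r d → answer r (WP.result wp r d)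
  where
  wp : WP σ (call SOLVER G) (Correct σ (𝒮 F))
  wp = wp-call (solver-wp σ G (skew-IGS igs) (<-wellFounded _))
         λ r c → wp-return (correct-≐ σ (solutions-IGS igs) r c)

  answer : ∀ r → Correct σ (𝒮 F) r →
           (r ≡ UNSAT ⇔ Empty (𝒮 F)) × (¬ Empty (𝒮 F) → ∃ λ a → r ≡ SAT a × 𝒮 F a)
  answer UNSAT   empty = mk⇔ (λ _ → empty) (λ _ → refl) , contradiction empty
  answer (SAT a) s     = mk⇔ (λ ()) (λ empty → contradiction s (empty a)) , λ _ → a , refl , s
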